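{- Let $G=(V,E)$ be a graph with $n$ vertices, $m$ edges, maximum degree $\Delta$ and arboricity $\alpha$. Procedure Arboricity Edge-Coloring with parameter $h\le\log\alpha$ computes a proper $(\Delta+3\cdot2^h)$-edge-coloring of $G$ in $O\left(\frac{m\alpha^7\log n}{2^{7h}}\right)$ deterministic time. Its randomized version requires $O\left(\frac{m\alpha\log n}{2^h}\right)$ expected time.
   Context: Logarithms are base 2. The arboricity of $G$ is $\max_{S\subseteq V,|S|\ge2}\lceil |E(G[S])|/(|S|-1)\rceil$. A proper $k$-edge-coloring is a map $\varphi:E\to\{1,\dots,k\}$ with distinct colors on distinct edges sharing an endpoint. An oriented degree-splitting of $(H,\mu)$ with discrepancy $\kappa$ is a partition $(E_1,E_2)$ of $E(H)$ such that for every vertex $v$, the numbers of incoming edges of $v$ in $E_1$ and in $E_2$ differ by at most $\kappa$, and likewise for outgoing edges. Procedure Forests-Decomposition Orientation$(G)$: starting from $\mathcal A=V$, repeatedly pick $v\in\mathcal A$ of minimum degree in $G[\mathcal A]$, orient every edge from $v$ to its neighbours in $\mathcal A$, and remove $v$ from $\mathcal A$, until $\mathcal A=\emptyset$. Procedure Oriented Edge-Coloring$(H,\mu,h)$: if $h=0$, return a proper $(\Delta(H)+1)$-edge-coloring of $H$ computed by a base-case subroutine; otherwise compute in $O(|E(H)|)$ time an oriented degree-splitting $(E_1,E_2)$ of $(H,\mu)$ with discrepancy at most 1, let $H_1=(V,E_1)$, $H_2=(V,E_2)$ with orientation induced by $\mu$, compute $\varphi_1=$ Oriented Edge-Coloring$(H_1,\mu,h-1)$,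 $\varphi_2=$ Oriented Edge-Coloring$(H_2,\mu,h-1)$, and return $\varphi=\varphi_1$ on $E_1$ and $\varphi=p_1+\varphi_2$ on $E_2$, where $p_1$ is the palette size of $\varphi_1$. Procedure Arboricity Edge-Coloring$(G,h)$: compute $\mu=$ Forests-Decomposition Orientation$(G)$ and return Oriented Edge-Coloring$(G,\mu,h)$. Deterministic version: the base-case subroutine is a deterministic algorithm computing a proper $(\Delta'+1)$-edge-coloring of an $n'$-vertex $m'$-edge graph with maximum degree $\Delta'$ and arboricity $\alpha'$ in $O(m'\alpha'^7\log n')$ time. Randomized version: the base-case subroutine is a randomized algorithm computing a proper $(\Delta'+1)$-edge-coloring in expected $O(m'\alpha'\log n')$ time. -}

module Defs where

open import Algebra.Properties.Monoid.Sum using (sum)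
open import Data.Bool.Base using (Bool; true; false; not; _∨_; _∧_; if_then_else_; T)
open import Data.Bool.Properties using (T?)
open import Data.Fin.Base using (Fin)
import Data.Fin.Properties as Fin
open import Data.Fin.Subset using (Subset; inside; outside; ∣_∣) renaming (_-_ to _without_)
open import Data.Fin.Subset.Properties using (_∈?_)
open import Data.Integer.Base using (+_)
open import Data.List.Base using (List; []; _∷_; allFin; cartesianProduct; filter; length; map; null)
open import Data.List.Extrema.Nat using (max)
open import Data.Maybe.Base using (Maybe; just; nothing)
open import Data.Nat.Base using (ℕ; zero; suc; _+_; _*_; _^_; _≤_; _⊔_; ∣_-_∣)
open import Data.Nat.DivMod using (_/_)
open import Data.Nat.Logarithm using (⌈log₂_⌉)
open import Data.Nat.Properties using (_≟_; m^n≢0)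
open import Data.Product.Base using (Σ; ∃; _×_; _,_; proj₁; proj₂)
open import Data.Rational.Base as ℚ using (ℚ; 0ℚ; 1ℚ)
import Data.Rational.Properties as ℚ
open import Data.Sum.Base using (_⊎_; inj₁; inj₂)
open import Data.Unit.Base using (⊤; tt)
open import Data.Vec.Base as Vec using ([]; _∷_)
open import Level using (Level) renaming (zero to 0ℓ; suc to lsuc)
open import Relation.Binary.PropositionalEquality.Core using (_≡_; _≢_)
open import Relation.Nullary.Decidable using (yes; no; does; _×-dec_)
open import Relation.Nullary.Negation using (¬_)

record Graph (n : ℕ) : Set where
  field
    adj       : Fin n → Fin n → Bool
    symmetric : ∀ u v → adj u v ≡ adj v u
    loopless  : ∀ v → adj v v ≡ false

  Edge : Fin n → Fin n → Set
  Edge u v = T (adj u v)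

open Graph public

-- Every edge {u , v} is listed once, as the pair with u < v.
edges : ∀ {n} → Graph n → List (Fin n × Fin n)
edges {n} G =
  filter (λ (u , v) → (u Fin.<? v) ×-dec T? (adj G u v))
         (cartesianProduct (allFin n) (allFin n))

numEdges : ∀ {n} → Graph n → ℕ
numEdges G = length (edges G)

numEdgesIn : ∀ {n} → Graph n → Subset n → ℕ
numEdgesIn G S = length (filter (λ (u , v) → (u ∈? S) ×-dec (v ∈? S)) (edges G))

neighbours : ∀ {n} → Graph n → Fin n → List (Fin n)
neighbours {n} G v = filter (λ u → T? (adj G v u)) (allFin n)

degree : ∀ {n} → Graph n → Fin n → ℕ
degree G v = length (neighbours G v)

maxDegree : ∀ {n} → Graph n → ℕ
maxDegree {n} G = max 0 (map (degree G) (allFin n))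

-- ⌈ e / (s ∸ 1) ⌉ for s ≥ 2; the value 0 for s < 2 does not affect the
-- maximum defining the arboricity.
density : (e s : ℕ) → ℕ
density e zero          = 0
density e (suc zero)    = 0
density e (suc (suc k)) = (e + k) / suc k

maxOverSubsets : ∀ n → (Subset n → ℕ) → ℕ
maxOverSubsets zero    f = f []
maxOverSubsets (suc n) f =
  maxOverSubsets n (λ S → f (outside ∷ S)) ⊔ maxOverSubsets n (λ S → f (inside ∷ S))

arboricity : ∀ {n} → Graph n → ℕ
arboricity {n} G = maxOverSubsets n (λ S → density (numEdgesIn G S) ∣ S ∣)

-- A map on E is represented by a map on ordered pairs; its values on
-- non-edges are irrelevant.
record IsProperEdgeColoring {n} (G : Graph n) (k : ℕ) (φ : Fin n → Fin n → ℕ) : Set where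
  field
    undirected : ∀ u v → Edge G u v → φ u v ≡ φ v u
    inPalette  : ∀ u v → Edge G u v → 1 ≤ φ u v × φ u v ≤ k
    proper     : ∀ u v w → Edge G u v → Edge G u w → v ≢ w → φ u v ≢ φ u w

record Coloring (n : ℕ) : Set where
  constructor coloring
  field
    palette : ℕ
    color   : Fin n → Fin n → ℕ

open Coloring public

-- μ u v ≡ true means u → v. Values on non-edges are irrelevant, so the
-- orientation that μ induces on a subgraph is μ itself.
Orientation : ℕ → Set
Orientation n = Fin n → Fin n → Bool

IsOrientation : ∀ {n} → Graph n → Orientation n → Set
IsOrientation H μ = ∀ u v → Edge H u v → μ v u ≡ not (μ u v)

inDegree : ∀ {n} → Graph n → Orientation n → Fin n → ℕ
inDegree {n} H μ v = length (filter (λ u → T? (adj H u v) ×-dec T? (μ u v)) (allFin n))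

outDegree : ∀ {n} → Graph n → Orientation n → Fin n → ℕ
outDegree {n} H μ v = length (filter (λ u → T? (adj H v u) ×-dec T? (μ v u)) (allFin n))

record IsOrientedSplitting {n} (H : Graph n) (μ : Orientation n) (κ : ℕ)
                           (H₁ H₂ : Graph n) : Set where
  field
    covers         : ∀ u v → adj H u v ≡ adj H₁ u v ∨ adj H₂ u v
    disjoint       : ∀ u v → ¬ (Edge H₁ u v × Edge H₂ u v)
    inDiscrepancy  : ∀ v → ∣ inDegree H₁ μ v - inDegree H₂ μ v ∣ ≤ κ
    outDiscrepancy : ∀ v → ∣ outDegree H₁ μ v - outDegree H₂ μ v ∣ ≤ κ

-- Running time is the number of ticks; the procedures below tick once per
-- elementary step (array or bucket access, edge visited, procedure call).
record CostMonad ℓ : Set (lsuc (lsuc 0ℓ Level.⊔ ℓ)) where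
  infixl 1 _>>=_ _>>_
  field
    M      : Set → Set ℓ
    return : {A : Set} → A → M A
    _>>=_  : {A B : Set} → M A → (A → M B) → M B
    tick   : M ⊤

  _>>_ : {A B : Set} → M A → M B → M B
  p >> q = p >>= λ _ → q

  ticks : ℕ → M ⊤
  ticks zero    = return tt
  ticks (suc t) = tick >> ticks t

record Timed (A : Set) : Set where
  constructor _after_
  field
    value : A
    time  : ℕ

open Timed public

deterministic : CostMonad 0ℓ
deterministic = record
  { M      = Timed
  ; return = λ a → a after 0
  ; _>>=_  = λ p f → value (f (value p)) after (time p + time (f (value p)))
  ; tick   = tt after 1
  }

-- A randomized computation is a probabilistic transition system. One step
-- takes one unit of time and draws a uniformly random element of
-- Fin (suc k), where k may depend on the state. Infinite runs are allowed.
record Rand (A : Set) : Set₁ where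
  field
    State : Set
    start : State
    step  : State → A ⊎ (Σ ℕ λ k → Fin (suc k) → State)

module _ {A : Set} (p : Rand A) where
  open Rand p

  -- Outputs s a: with positive probability, the run from s halts with a.
  data Outputs (s : State) (a : A) : Set where
    halt : step s ≡ inj₁ a → Outputs s a
    draw : ∀ {k f} → step s ≡ inj₂ (k , f) → (i : Fin (suc k)) → Outputs (f i) a → Outputs s a

  -- The expectation of the minimum of t and the running time from s.
  truncatedExpectation : (t : ℕ) → State → ℚ
  truncatedExpectation zero    s = 0ℚ
  truncatedExpectation (suc t) s with step s
  ... | inj₁ a       = 0ℚ
  ... | inj₂ (k , f) =
    1ℚ ℚ.+ sum ℚ.+-0-monoid (λ i → truncatedExpectation t (f i)) ℚ.* (+ 1 ℚ./ suc k)

  MayOutput : A → Set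
  MayOutput = Outputs start

  -- E[T] is the supremum over t of E[min(t , T)] (monotone convergence), so
  -- this says E[T] ≤ b; in particular the run then halts almost surely.
  ExpectedTime≤ : ℚ → Set
  ExpectedTime≤ b = ∀ t → truncatedExpectation t start ℚ.≤ b

module _ {A B : Set} (p : Rand A) (f : A → Rand B) where
  BindState : Set
  BindState = Rand.State p ⊎ (Σ A λ a → Rand.State (f a))

  step₂ : (a : A) → Rand.State (f a) → B ⊎ (Σ ℕ λ k → Fin (suc k) → BindState)
  step₂ a s with Rand.step (f a) s
  ... | inj₁ b       = inj₁ b
  ... | inj₂ (k , g) = inj₂ (k , λ i → inj₂ (a , g i))

  bindStep : BindState → B ⊎ (Σ ℕ λ k → Fin (suc k) → BindState)
  bindStep (inj₁ s) with Rand.step p s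
  ... | inj₁ a       = step₂ a (Rand.start (f a))
  ... | inj₂ (k , g) = inj₂ (k , λ i → inj₁ (g i))
  bindStep (inj₂ (a , s)) = step₂ a s

  bindRand : Rand B
  bindRand = record { State = BindState ; start = inj₁ (Rand.start p) ; step = bindStep }

randomized : CostMonad (lsuc 0ℓ)
randomized = record
  { M      = Rand
  ; return = λ a → record { State = ⊤ ; start = tt ; step = λ _ → inj₁ a }
  ; _>>=_  = bindRand
  ; tick   = record
      { State = Bool
      ; start = false
      ; step  = λ { false → inj₂ (0 , λ _ → true) ; true → inj₁ tt }
      }
  }

fromℕ : ℕ → ℚ
fromℕ a = + a ℚ./ 1

infix 7 _/2^_
_/2^_ : ℕ → ℕ → ℚ
a /2^ j = (+ a ℚ./ (2 ^ j)) {{m^n≢0 2 j}}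

module _ {n : ℕ} (G : Graph n) where
  open CostMonad deterministic

  degreeIn : Subset n → Fin n → ℕ
  degreeIn A v = length (filter (_∈? A) (neighbours G v))

  -- The vertices of A are kept in buckets (doubly linked lists) indexed by
  -- their degree in G[A]. A vertex of minimum degree is found by probing
  -- the buckets k, k + 1, …, at one tick per probe.
  findMin : (probes : ℕ) (A : Subset n) (k : ℕ) → Timed (Maybe (Fin n))
  findMin zero     A k = return nothing
  findMin (suc ps) A k = tick >> probe
    where
    probe : Timed (Maybe (Fin n))
    probe with Fin.any? (λ v → (v ∈? A) ×-dec (degreeIn A v ≟ k))
    ... | yes (v , _) = return (just v)
    ... | no  _       = findMin ps A (suc k)

  -- Set v → u, overwriting any previous value for the pair {u , v}.
  orient : Fin n → Fin n → Orientation n → Orientation n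
  orient v u μ x y =
    if does (x Fin.≟ v) ∧ does (y Fin.≟ u) then true
    else if does (x Fin.≟ u) ∧ does (y Fin.≟ v) then false
    else μ x y

  -- The tick of a list entry u also pays for moving u to the next lower
  -- bucket.
  orientAll : Fin n → Subset n → List (Fin n) → Orientation n → Timed (Orientation n)
  orientAll v A []       μ = return μ
  orientAll v A (u ∷ us) μ =
    tick >> orientAll v A us (if does (u ∈? A) then orient v u μ else μ)

  -- Called with rounds = ∣ A ∣. All degrees are below n, so n probes find a
  -- vertex whenever A is nonempty.
  eliminate : (rounds : ℕ) (A : Subset n) → Orientation n → Timed (Orientation n)
  eliminate zero     A μ = return μ
  eliminate (suc rs) A μ = findMin n A 0 >>= λ where
    nothing  → return μ
    (just v) → orientAll v A (neighbours G v) μ >>= λ μ′ →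
               eliminate rs (A without v) μ′

  nonIsolated : Subset n
  nonIsolated = Vec.tabulate (λ v → not (null (neighbours G v)))

  -- Isolated vertices have minimum degree and no edge to orient, so they
  -- may be removed first. They do not occur in the input list of edges and
  -- cost nothing. Filling the buckets costs one tick per edge endpoint.
  forestsDecompositionOrientation : Timed (Orientation n)
  forestsDecompositionOrientation =
    ticks (2 * numEdges G) >> eliminate ∣ nonIsolated ∣ nonIsolated (λ _ _ → false)

Splitter : Set
Splitter = ∀ {n} → Graph n → Orientation n → Timed (Graph n × Graph n)

merge : ∀ {n} → Graph n → Coloring n → Coloring n → Coloring n
merge H₁ φ₁ φ₂ = coloring (palette φ₁ + palette φ₂)
  (λ u v → if adj H₁ u v then color φ₁ u v else palette φ₁ + color φ₂ u v)

module _ {ℓ} (𝓜 : CostMonad ℓ) where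
  open CostMonad 𝓜

  BaseCase : Set ℓ
  BaseCase = ∀ {n} → Graph n → M (Coloring n)

  liftTimed : {A : Set} → Timed A → M A
  liftTimed p = ticks (time p) >> return (value p)

  module _ (split : Splitter) (base : BaseCase) where

    orientedEdgeColoring : ∀ {n} → Graph n → Orientation n → ℕ → M (Coloring n)
    orientedEdgeColoring H μ zero    = tick >> base H
    orientedEdgeColoring H μ (suc h) =
      tick                                              >>
      liftTimed (split H μ)                             >>= λ (H₁ , H₂) →
      orientedEdgeColoring H₁ μ h                       >>= λ φ₁ →
      orientedEdgeColoring H₂ μ h                       >>= λ φ₂ →
      ticks (numEdges H)                                >>
      return (merge H₁ φ₁ φ₂)

    arboricityEdgeColoring : ∀ {n} → Graph n → ℕ → M (Coloring n)
    arboricityEdgeColoring G h =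
      liftTimed (forestsDecompositionOrientation G) >>= λ μ →
      orientedEdgeColoring G μ h

-- In the time bounds below, 1 + f stands for f because an algorithm needs
-- constant time even on an edgeless graph. Replacing log n by ⌈log₂ n⌉
-- changes f by at most a factor of 2, as f is 0 for n < 2.

record IsLinearTimeSplitter (split : Splitter) : Set where
  field
    splits : ∀ {n} (H : Graph n) (μ : Orientation n) → IsOrientation H μ →
             IsOrientedSplitting H μ 1 (proj₁ (value (split H μ))) (proj₂ (value (split H μ)))
    linear : ∃ λ c → ∀ {n} (H : Graph n) (μ : Orientation n) → IsOrientation H μ →
             time (split H μ) ≤ c * (1 + numEdges H)

IsBaseColoring : ∀ {n} → Graph n → Coloring n → Set
IsBaseColoring H φ =
  palette φ ≡ maxDegree H + 1 × IsProperEdgeColoring H (palette φ) (color φ)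

record IsDeterministicBaseCase (base : BaseCase deterministic) : Set where
  field
    colors : ∀ {n} (H : Graph n) → IsBaseColoring H (value (base H))
    fast   : ∃ λ c → ∀ {n} (H : Graph n) →
             time (base H) ≤ c * (1 + numEdges H * arboricity H ^ 7 * ⌈log₂ n ⌉)

record IsRandomizedBaseCase (base : BaseCase randomized) : Set where
  field
    colors : ∀ {n} (H : Graph n) φ → MayOutput (base H) φ → IsBaseColoring H φ
    fast   : ∃ λ c → ∀ {n} (H : Graph n) →
             ExpectedTime≤ (base H) (fromℕ (c * (1 + numEdges H * arboricity H * ⌈log₂ n ⌉)))

{-# OPTIONS --safe #-}

-- Orienting every edge out of a vertex of minimum remaining degree gives
-- out-degrees at most 2α. One oriented splitting takes an in- or out-degree x
-- to at most (x + 1)/2. Hence, if Δ bounds the total degrees, the two halves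
-- have total degrees at most Δ/2 + 1, and induction on h bounds the palette by
-- Δ + 3·2^h − 2. Likewise the leaves of the recursion have out-degrees
-- O(α/2^h), and an orientation with out-degrees at most d forces arboricity at
-- most 2d, even if it has directed cycles. So a leaf with m′ edges costs
-- O(1 + m′ (α/2^h)^e log n), and the leaves partition the edges; the remaining
-- O(2^h + (1 + h) m) time is absorbed because 2^h ≤ α ≤ m and h = O(log n).
-- The deterministic (e = 7) and randomized (e = 1) versions share one argument,
-- carried out in a Hoare logic with time credits.

module Submission where

open import Defs
open import Algebra.Properties.CommutativeMonoid.Sum using ()
open import Data.Bool.Base using (Bool; true; false; not; _∨_; _∧_; T)
open import Data.Bool.Properties using (T?; ∨-zeroʳ; ∧-comm)
open import Data.Fin.Base using (Fin; zero; suc)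
import Data.Fin.Properties as Fin
open import Data.Fin.Subset using (Subset; inside; outside; ∣_∣; _∈_; _∉_; ⁅_⁆) renaming (_-_ to _without_)
open import Data.Fin.Subset.Properties using (_∈?_; nonempty?; Empty-unique; ∣⊥∣≡0; p─⊥≡p; p─q⊆p; x∈p∧x≢y⇒x∈p-y)
import Data.Integer.Base as ℤ
import Data.Integer.Properties as ℤ
open import Data.List.Base using (List; []; _∷_; allFin; cartesianProduct; filter; length; map; null; tabulate; _++_)
open import Data.List.Extrema.Nat using (max≤v⁺; xs≤max)
open import Data.List.Membership.Propositional using () renaming (_∈_ to _∈ˡ_)
open import Data.List.Membership.Propositional.Properties using (∈-filter⁺; ∈-allFin)
import Data.List.Properties as List
import Data.List.Relation.Unary.All.Properties as All
open import Data.List.Relation.Unary.Any using (here; there)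
open import Data.Maybe.Base using (just)
open import Data.Nat.Base using (ℕ; zero; suc; _+_; _*_; _^_; _≤_; _<_; ∣_-_∣; z≤n; s≤s; NonZero; ⌊_/2⌋)
open import Data.Nat.DivMod using (_/_; _%_; m<n*o⇒m/o<n; m/n*n≤m; m≡m%n+[m/n]*n; m%n<n)
open import Data.Nat.Logarithm using (⌈log₂_⌉; ⌈log₂⌉-mono-≤; ⌈log₂2^n⌉≡n; ⌈log₂2*n⌉≡1+⌈log₂n⌉)
open import Data.Nat.Properties
open import Data.Nat.Tactic.RingSolver using (solve-∀)
open import Data.Product.Base using (∃; _×_; _,_; proj₁; proj₂)
open import Data.Rational.Base as ℚ using (ℚ; 0ℚ; 1ℚ)
import Data.Rational.Properties as ℚ
open import Data.Rational.Unnormalised.Base as ℚᵘ using (mkℚᵘ; *≤*; *≡*)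
import Data.Rational.Unnormalised.Properties as ℚᵘ
open import Data.Sum.Base using (_⊎_; inj₁; inj₂; [_,_]′)
open import Data.Unit.Base using (⊤; tt)
open import Data.Vec.Base using ([]; _∷_; here; there)
open import Data.Vec.Properties using (lookup∘tabulate; lookup⇒[]=; []=⇒lookup)
open import Function.Base using (_∘_; id)
open import Level using (0ℓ) renaming (suc to lsuc)
open import Relation.Binary.Definitions using (tri<; tri≈; tri>)
open import Relation.Binary.PropositionalEquality
open import Relation.Nullary.Decidable using (Dec; yes; no; does; _×-dec_; dec-true; dec-false)
open import Relation.Nullary.Negation using (¬_; contradiction)
open import Relation.Unary using (Pred; Decidable)

open Algebra.Properties.CommutativeMonoid.Sum +-0-commutativeMonoid
  using (sum; sum-cong-≗; ∑-distrib-+; ∑-comm)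
module ∑ℚ = Algebra.Properties.CommutativeMonoid.Sum ℚ.+-0-commutativeMonoid

-- The discrepancy conditions speak of degrees only, so arboricity is not followed through the
-- recursion. It is traded for out-degrees at the root and recovered from them at the leaves, at a
-- factor 2 each time; these factors and the rounding of `α / 2 ^ h` make up the constant 10 in the
-- final bound. Rounding is the obstacle to both inductions. It is removed by choosing bounds that
-- halve exactly: x ↦ x/2 + 1 fixes 2 and x ↦ (x + 1)/2 fixes 1, so total degrees are measured from
-- 2 and out-degrees from 1. The claimed time has no additive constant. The hypothesis
-- `2 ^ h ≤ arboricity G` therefore does double duty: it bounds the number of leaves, and it
-- excludes edgeless graphs, so that the edge count and `⌈log₂ n ⌉` are at least 1 and can pay for
-- constant costs. Cost estimates are made in ℕ after multiplying by `2 ^ (e * h)`; rationals enter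
-- only in expectations and in the final comparison.

private variable
  n : ℕ

-- Counting by sums of indicators

𝟙 : Bool → ℕ
𝟙 true  = 1
𝟙 false = 0

𝟙≤1 : ∀ b → 𝟙 b ≤ 1
𝟙≤1 true  = ≤-refl
𝟙≤1 false = z≤n

𝟙-mono : ∀ {a b} → (T a → T b) → 𝟙 a ≤ 𝟙 b
𝟙-mono {false}         _ = z≤n
𝟙-mono {true}  {true}  _ = ≤-refl
𝟙-mono {true}  {false} f = contradiction (f tt) λ ()

𝟙-∧ : ∀ a b → 𝟙 (a ∧ b) ≡ 𝟙 a * 𝟙 b
𝟙-∧ true  b = sym (+-identityʳ (𝟙 b))
𝟙-∧ false b = refl

𝟙-disjoint : ∀ a b c → ¬ (T a × T b) → 𝟙 ((a ∨ b) ∧ c) ≡ 𝟙 (a ∧ c) + 𝟙 (b ∧ c)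
𝟙-disjoint true  true  c ¬ab = contradiction (tt , tt) ¬ab
𝟙-disjoint true  false c ¬ab = sym (+-identityʳ (𝟙 c))
𝟙-disjoint false b     c ¬ab = refl

∧-intro : ∀ {a b} → T a → T b → T (a ∧ b)
∧-intro {true} _ b = b

∧-elim : ∀ {a b} → T (a ∧ b) → T a × T b
∧-elim {true} b = tt , b

does⇒ : ∀ {p} {P : Set p} (P? : Dec P) → T (does P?) → P
does⇒ (yes p) _ = p

⇒does : ∀ {p} {P : Set p} (P? : Dec P) → P → T (does P?)
⇒does (yes _) _ = tt
⇒does (no ¬p) p = ¬p p

T⇒≡true : ∀ {b} → T b → b ≡ true
T⇒≡true {true} _ = refl

sum-mono-≤ : {f g : Fin n → ℕ} → (∀ i → f i ≤ g i) → sum f ≤ sum g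
sum-mono-≤ {zero}  f≤g = z≤n
sum-mono-≤ {suc n} f≤g = +-mono-≤ (f≤g zero) (sum-mono-≤ (f≤g ∘ suc))

sum-*ˡ : ∀ c (f : Fin n → ℕ) → sum (λ i → c * f i) ≡ c * sum f
sum-*ˡ {zero}  c f = sym (*-zeroʳ c)
sum-*ˡ {suc n} c f =
  trans (cong (c * f zero +_) (sum-*ˡ c (f ∘ suc))) (sym (*-distribˡ-+ c (f zero) (sum (f ∘ suc))))

sum-*ʳ : ∀ c (f : Fin n → ℕ) → sum (λ i → f i * c) ≡ sum f * c
sum-*ʳ c f =
  trans (sum-cong-≗ (λ i → *-comm (f i) c)) (trans (sum-*ˡ c f) (*-comm c (sum f)))

sum≤n*c : ∀ c {f : Fin n → ℕ} → (∀ i → f i ≤ c) → sum f ≤ n * c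
sum≤n*c {zero}  c f≤c = z≤n
sum≤n*c {suc n} c f≤c = +-mono-≤ (f≤c zero) (sum≤n*c c (f≤c ∘ suc))

term≤sum : (f : Fin n → ℕ) → ∀ i → f i ≤ sum f
term≤sum f zero    = m≤m+n (f zero) _
term≤sum f (suc i) = ≤-trans (term≤sum (f ∘ suc) i) (m≤n+m _ (f zero))

length-filter-tabulate : ∀ {A : Set} {P : Pred A 0ℓ} (P? : Decidable P) (f : Fin n → A) →
  length (filter P? (tabulate f)) ≡ sum (λ i → 𝟙 (does (P? (f i))))
length-filter-tabulate {zero}  P? f = refl
length-filter-tabulate {suc n} P? f with does (P? (f zero))
... | true  = cong suc (length-filter-tabulate P? (f ∘ suc))
... | false = length-filter-tabulate P? (f ∘ suc)

length-filter-allFin : {P : Pred (Fin n) 0ℓ} (P? : Decidable P) →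
  length (filter P? (allFin n)) ≡ sum (λ i → 𝟙 (does (P? i)))
length-filter-allFin P? = length-filter-tabulate P? id

length-filter-cartesianProduct : ∀ {m} {A B : Set} {P : Pred (A × B) 0ℓ} (P? : Decidable P)
  (f : Fin m → A) (g : Fin n → B) →
  length (filter P? (cartesianProduct (tabulate f) (tabulate g))) ≡
  sum (λ i → sum (λ j → 𝟙 (does (P? (f i , g j)))))
length-filter-cartesianProduct {m = zero} P? f g = refl
length-filter-cartesianProduct {m = suc m} P? f g = begin
  length (filter P? (row ++ rest))                        ≡⟨ cong length (List.filter-++ P? row rest) ⟩
  length (filter P? row ++ filter P? rest)                ≡⟨ List.length-++ (filter P? row) ⟩
  length (filter P? row) + length (filter P? rest)        ≡⟨ cong₂ _+_ eq (length-filter-cartesianProduct P? (f ∘ suc) g) ⟩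
  _                                                       ∎
  where
  open ≡-Reasoning
  row  = map (f zero ,_) (tabulate g)
  rest = cartesianProduct (tabulate (f ∘ suc)) (tabulate g)
  eq : length (filter P? row) ≡ sum (λ j → 𝟙 (does (P? (f zero , g j))))
  eq = trans (cong (length ∘ filter P?) (List.map-tabulate g (f zero ,_)))
             (length-filter-tabulate P? (λ j → f zero , g j))

filter-filter : ∀ {A : Set} {P Q : Pred A 0ℓ} (P? : Decidable P) (Q? : Decidable Q) xs →
  filter Q? (filter P? xs) ≡ filter (λ x → P? x ×-dec Q? x) xs
filter-filter P? Q? [] = refl
filter-filter P? Q? (x ∷ xs) with does (P? x)
... | false = filter-filter P? Q? xs
... | true with does (Q? x)
...   | true  = cong (x ∷_) (filter-filter P? Q? xs)
...   | false = filter-filter P? Q? xs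

_∋_ : Subset n → Fin n → Bool
A ∋ v = does (v ∈? A)

card-∑ : (A : Subset n) → ∣ A ∣ ≡ sum (λ v → 𝟙 (A ∋ v))
card-∑ []            = refl
card-∑ (inside ∷ A)  = cong suc (card-∑ A)
card-∑ (outside ∷ A) = card-∑ A

_<ᵇ_ : Fin n → Fin n → Bool
u <ᵇ v = does (u Fin.<? v)

module _ (G : Graph n) where

  adj-sym : ∀ {u v} → Edge G u v → Edge G v u
  adj-sym {u} {v} = subst T (symmetric G u v)

  no-loop : ∀ {v} → ¬ Edge G v v
  no-loop {v} = subst T (loopless G v)

  numEdges-∑ : numEdges G ≡ sum (λ u → sum (λ v → 𝟙 (u <ᵇ v ∧ adj G u v)))
  numEdges-∑ = length-filter-cartesianProduct
    (λ (u , v) → (u Fin.<? v) ×-dec T? (adj G u v)) id id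

  numEdgesIn-∑ : ∀ S → numEdgesIn G S ≡
    sum (λ u → sum (λ v → 𝟙 ((u <ᵇ v ∧ adj G u v) ∧ (S ∋ u ∧ S ∋ v))))
  numEdgesIn-∑ S = trans
    (cong length (filter-filter (λ (u , v) → (u Fin.<? v) ×-dec T? (adj G u v))
                                (λ (u , v) → (u ∈? S) ×-dec (v ∈? S)) (cartesianProduct (allFin n) (allFin n))))
    (length-filter-cartesianProduct
      (λ (u , v) → ((u Fin.<? v) ×-dec T? (adj G u v)) ×-dec ((u ∈? S) ×-dec (v ∈? S))) id id)

  numEdgesIn≤numEdges : ∀ S → numEdgesIn G S ≤ numEdges G
  numEdgesIn≤numEdges S = List.length-filter (λ (u , v) → (u ∈? S) ×-dec (v ∈? S)) (edges G)

  degree-∑ : ∀ v → degree G v ≡ sum (λ u → 𝟙 (adj G v u))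
  degree-∑ v = length-filter-allFin (λ u → T? (adj G v u))

  degreeIn-∑ : ∀ A v → degreeIn G A v ≡ sum (λ u → 𝟙 (adj G v u ∧ A ∋ u))
  degreeIn-∑ A v = trans
    (cong length (filter-filter (λ u → T? (adj G v u)) (_∈? A) (allFin n)))
    (length-filter-allFin (λ u → T? (adj G v u) ×-dec (u ∈? A)))

  inDegree-∑ : ∀ μ v → inDegree G μ v ≡ sum (λ u → 𝟙 (adj G u v ∧ μ u v))
  inDegree-∑ μ v = length-filter-allFin (λ u → T? (adj G u v) ×-dec T? (μ u v))

  outDegree-∑ : ∀ μ v → outDegree G μ v ≡ sum (λ u → 𝟙 (adj G v u ∧ μ v u))
  outDegree-∑ μ v = length-filter-allFin (λ u → T? (adj G v u) ×-dec T? (μ v u))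

𝟙-< : ∀ (u v : Fin n) → u ≢ v → 𝟙 (u <ᵇ v) + 𝟙 (v <ᵇ u) ≡ 1
𝟙-< u v u≢v with Fin.<-cmp u v
... | tri< u<v _ v≮u rewrite dec-true (u Fin.<? v) u<v | dec-false (v Fin.<? u) v≮u = refl
... | tri≈ _ u≡v _ = contradiction u≡v u≢v
... | tri> u≮v _ v<u rewrite dec-false (u Fin.<? v) u≮v | dec-true (v Fin.<? u) v<u = refl

-- A sum over ordered pairs, rearranged along the convention of Defs.edges that
-- an edge is listed once, as the pair with u < v.
sum-unordered : (f : Fin n → Fin n → ℕ) → (∀ u → f u u ≡ 0) →
  sum (λ u → sum (λ v → f u v)) ≡ sum (λ u → sum (λ v → 𝟙 (u <ᵇ v) * (f u v + f v u)))
sum-unordered {n} f diag = begin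
  sum (λ u → sum (λ v → f u v))
    ≡⟨ sum-cong-≗ (λ u → sum-cong-≗ (λ v → bySide u v)) ⟩
  sum (λ u → sum (λ v → X u v + Y v u))
    ≡⟨ split X (λ u v → Y v u) ⟩
  sum (λ u → sum (X u)) + sum (λ u → sum (λ v → Y v u))
    ≡⟨ cong (sum (λ u → sum (X u)) +_) (∑-comm (λ u v → Y v u)) ⟩
  sum (λ u → sum (X u)) + sum (λ v → sum (λ u → Y v u))
    ≡⟨ split X Y ⟨
  sum (λ u → sum (λ v → X u v + Y u v))
    ≡⟨ sum-cong-≗ (λ u → sum-cong-≗ (λ v → *-distribˡ-+ (𝟙 (u <ᵇ v)) (f u v) (f v u))) ⟨
  sum (λ u → sum (λ v → 𝟙 (u <ᵇ v) * (f u v + f v u))) ∎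
  where
  open ≡-Reasoning
  X Y : Fin n → Fin n → ℕ
  X u v = 𝟙 (u <ᵇ v) * f u v
  Y u v = 𝟙 (u <ᵇ v) * f v u
  split : ∀ (X Y : Fin n → Fin n → ℕ) → sum (λ u → sum (λ v → X u v + Y u v)) ≡
          sum (λ u → sum (X u)) + sum (λ u → sum (Y u))
  split X Y = trans (sum-cong-≗ (λ u → ∑-distrib-+ (X u) (Y u)))
                    (∑-distrib-+ (λ u → sum (X u)) (λ u → sum (Y u)))
  -- Each ordered pair is filed under `X` or, with its indices swapped, under `Y`, according to
  -- which entry is smaller. Exchanging the two sums over `Y` then brings both under `u <ᵇ v`.
  bySide : ∀ u v → f u v ≡ X u v + Y v u
  bySide u v with u Fin.≟ v
  ... | yes refl rewrite diag u | *-zeroʳ (𝟙 (u <ᵇ u)) = refl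
  ... | no u≢v = begin
    f u v                                ≡⟨ *-identityˡ (f u v) ⟨
    1 * f u v                            ≡⟨ cong (_* f u v) (𝟙-< u v u≢v) ⟨
    (𝟙 (u <ᵇ v) + 𝟙 (v <ᵇ u)) * f u v    ≡⟨ *-distribʳ-+ (f u v) (𝟙 (u <ᵇ v)) (𝟙 (v <ᵇ u)) ⟩
    X u v + Y v u                        ∎

𝟙-false : ∀ {b} → ¬ T b → 𝟙 b ≡ 0
𝟙-false {true}  ¬b = contradiction tt ¬b
𝟙-false {false} _  = refl

module _ (G : Graph n) where

  sum-degree≤ : sum (degree G) ≤ 2 * numEdges G
  sum-degree≤ = begin
    sum (degree G)                                         ≡⟨ sum-cong-≗ (degree-∑ G) ⟩
    sum (λ u → sum (λ v → f u v))                          ≡⟨ sum-unordered f (λ u → 𝟙-false (no-loop G)) ⟩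
    sum (λ u → sum (λ v → 𝟙 (u <ᵇ v) * (f u v + f v u)))
      ≡⟨ sum-cong-≗ (λ u → trans (sum-cong-≗ (pointwise u)) (sum-*ˡ 2 (e u))) ⟩
    sum (λ u → 2 * sum (λ v → 𝟙 (u <ᵇ v ∧ adj G u v)))     ≡⟨ sum-*ˡ 2 (λ u → sum (e u)) ⟩
    2 * sum (λ u → sum (λ v → 𝟙 (u <ᵇ v ∧ adj G u v)))     ≡⟨ cong (2 *_) (numEdges-∑ G) ⟨
    2 * numEdges G                                         ∎
    where
    open ≤-Reasoning
    f e : Fin n → Fin n → ℕ
    f u v = 𝟙 (adj G u v)
    e u v = 𝟙 (u <ᵇ v ∧ adj G u v)
    arith : ∀ a b → a * (b + b) ≡ 2 * (a * b)
    arith = solve-∀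
    pointwise : ∀ u v → 𝟙 (u <ᵇ v) * (f u v + f v u) ≡ 2 * e u v
    pointwise u v rewrite symmetric G v u | 𝟙-∧ (u <ᵇ v) (adj G u v) =
      arith (𝟙 (u <ᵇ v)) (𝟙 (adj G u v))

  -- Handshake lemma for the induced subgraph `G[A]`.
  sum-degreeIn≤ : ∀ A → sum (λ u → 𝟙 (A ∋ u) * degreeIn G A u) ≤ 2 * numEdgesIn G A
  sum-degreeIn≤ A = begin
    sum (λ u → 𝟙 (A ∋ u) * degreeIn G A u)                 ≡⟨ sum-cong-≗ expand ⟩
    sum (λ u → sum (λ v → f u v))                          ≡⟨ sum-unordered f diag ⟩
    sum (λ u → sum (λ v → 𝟙 (u <ᵇ v) * (f u v + f v u)))
      ≡⟨ sum-cong-≗ (λ u → trans (sum-cong-≗ (pointwise u)) (sum-*ˡ 2 (e u))) ⟩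
    sum (λ u → 2 * sum (λ v → e u v))                      ≡⟨ sum-*ˡ 2 (λ u → sum (e u)) ⟩
    2 * sum (λ u → sum (λ v → e u v))                      ≡⟨ cong (2 *_) (numEdgesIn-∑ G A) ⟨
    2 * numEdgesIn G A                                     ∎
    where
    open ≤-Reasoning
    f e : Fin n → Fin n → ℕ
    f u v = 𝟙 (A ∋ u) * 𝟙 (adj G u v ∧ A ∋ v)
    e u v = 𝟙 ((u <ᵇ v ∧ adj G u v) ∧ (A ∋ u ∧ A ∋ v))
    diag : ∀ u → f u u ≡ 0
    diag u rewrite loopless G u = *-zeroʳ (𝟙 (A ∋ u))
    expand : ∀ u → 𝟙 (A ∋ u) * degreeIn G A u ≡ sum (f u)
    expand u = trans (cong (𝟙 (A ∋ u) *_) (degreeIn-∑ G A u)) (sym (sum-*ˡ (𝟙 (A ∋ u)) (λ v → 𝟙 (adj G u v ∧ A ∋ v))))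
    arith : ∀ l a x y → l * (x * (a * y) + y * (a * x)) ≡ 2 * (l * a * (x * y))
    arith = solve-∀
    pointwise : ∀ u v → 𝟙 (u <ᵇ v) * (f u v + f v u) ≡ 2 * e u v
    pointwise u v rewrite symmetric G v u | 𝟙-∧ (adj G u v) (A ∋ v) | 𝟙-∧ (adj G u v) (A ∋ u)
                        | 𝟙-∧ (u <ᵇ v ∧ adj G u v) (A ∋ u ∧ A ∋ v)
                        | 𝟙-∧ (u <ᵇ v) (adj G u v) | 𝟙-∧ (A ∋ u) (A ∋ v) =
      arith (𝟙 (u <ᵇ v)) (𝟙 (adj G u v)) (𝟙 (A ∋ u)) (𝟙 (A ∋ v))

-- Density, arboricity and out-degrees

≤maxOverSubsets : (f : Subset n → ℕ) → ∀ S → f S ≤ maxOverSubsets n f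
≤maxOverSubsets f []            = ≤-refl
≤maxOverSubsets f (outside ∷ S) = m≤n⇒m≤n⊔o _ (≤maxOverSubsets (λ S → f (outside ∷ S)) S)
≤maxOverSubsets f (inside ∷ S)  = m≤n⇒m≤o⊔n _ (≤maxOverSubsets (λ S → f (inside ∷ S)) S)

maxOverSubsets≤ : ∀ {b} (f : Subset n → ℕ) → (∀ S → f S ≤ b) → maxOverSubsets n f ≤ b
maxOverSubsets≤ {zero}  f f≤b = f≤b []
maxOverSubsets≤ {suc n} f f≤b =
  ⊔-lub (maxOverSubsets≤ _ (λ S → f≤b (outside ∷ S))) (maxOverSubsets≤ _ (λ S → f≤b (inside ∷ S)))

-- For s ≥ 2 one has s ≤ 2(s - 1), so the quotient before rounding is at most 2d, and the ceiling
-- cannot pass the integer 2d. The surplus 2(s - 1) - s is the `k` in the added term `d * k`.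
density≤ : ∀ {e d} s → e ≤ d * s → density e s ≤ 2 * d
density≤ zero          _ = z≤n
density≤ (suc zero)    _ = z≤n
density≤ {e} {d} (suc (suc k)) e≤ = ≤-pred (m<n*o⇒m/o<n (begin-strict
  e + k                      ≤⟨ +-monoˡ-≤ k e≤ ⟩
  d * (2 + k) + k            <⟨ ≤-reflexive (arith₁ d k) ⟩
  d * (2 + k) + suc k        ≤⟨ m≤m+n _ (d * k) ⟩
  d * (2 + k) + suc k + d * k ≡⟨ arith₂ d k ⟩
  suc (2 * d) * suc k        ∎))
  where
  open ≤-Reasoning
  arith₁ : ∀ d k → suc (d * (2 + k) + k) ≡ d * (2 + k) + suc k
  arith₁ = solve-∀
  arith₂ : ∀ d k → d * (2 + k) + suc k + d * k ≡ suc (2 * d) * suc k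
  arith₂ = solve-∀

density≤edges : ∀ e s → density e s ≤ e
density≤edges e zero          = z≤n
density≤edges e (suc zero)    = z≤n
density≤edges e (suc (suc k)) = ≤-pred (m<n*o⇒m/o<n (begin-strict
  e + k          <⟨ s≤s (m≤m+n (e + k) (e * k)) ⟩
  suc (e + k + e * k) ≡⟨ arith e k ⟩
  suc e * suc k  ∎))
  where
  open ≤-Reasoning
  arith : ∀ e k → suc (e + k + e * k) ≡ suc e * suc k
  arith = solve-∀

-- The `k` added before the division, which makes it a ceiling, absorbs the remainder, itself at
-- most `k`.
edges≤density*size : ∀ e k → e ≤ density e (2 + k) * suc k
edges≤density*size e k = +-cancelʳ-≤ k e _ (begin
  e + k                                            ≡⟨ m≡m%n+[m/n]*n (e + k) (suc k) ⟩
  _                                                ≤⟨ +-monoˡ-≤ _ (≤-pred (m%n<n (e + k) (suc k))) ⟩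
  k + (e + k) / suc k * suc k                      ≡⟨ +-comm k _ ⟩
  (e + k) / suc k * suc k + k                      ∎)
  where open ≤-Reasoning

module _ (G : Graph n) where

  arboricity≤numEdges : arboricity G ≤ numEdges G
  arboricity≤numEdges = maxOverSubsets≤ _ λ S →
    ≤-trans (density≤edges _ ∣ S ∣) (numEdgesIn≤numEdges G S)

  numEdgesIn≤arboricity : ∀ S {k} → ∣ S ∣ ≡ 2 + k → numEdgesIn G S ≤ arboricity G * suc k
  numEdgesIn≤arboricity S {k} eq = ≤-trans (edges≤density*size (numEdgesIn G S) k)
    (*-monoˡ-≤ (suc k) (subst (λ s → density (numEdgesIn G S) s ≤ arboricity G) eq
      (≤maxOverSubsets (λ S → density (numEdgesIn G S) ∣ S ∣) S)))

  module _ (μ : Orientation n) (oriented : IsOrientation G μ) where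

    -- Charge each edge of `G[S]` to its tail, a vertex of `S`; arcs that leave `S` only enlarge the
    -- right side.
    numEdgesIn≤outDegree : ∀ {d} → (∀ v → outDegree G μ v ≤ d) → ∀ S → numEdgesIn G S ≤ d * ∣ S ∣
    numEdgesIn≤outDegree {d} out≤d S = begin
      numEdgesIn G S                                         ≡⟨ numEdgesIn-∑ G S ⟩
      sum (λ u → sum (λ v → e u v))                          ≤⟨ sum-mono-≤ (λ u → sum-mono-≤ (pointwise u)) ⟩
      sum (λ u → sum (λ v → 𝟙 (u <ᵇ v) * (f u v + f v u)))   ≡⟨ sum-unordered f diag ⟨
      sum (λ u → sum (λ v → f u v))                          ≡⟨ sum-cong-≗ (λ u → sum-*ˡ (𝟙 (S ∋ u)) (λ v → 𝟙 (adj G u v ∧ μ u v))) ⟩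
      sum (λ u → 𝟙 (S ∋ u) * sum (λ v → 𝟙 (adj G u v ∧ μ u v)))
        ≤⟨ sum-mono-≤ (λ u → *-monoʳ-≤ (𝟙 (S ∋ u)) (subst (_≤ d) (outDegree-∑ G μ u) (out≤d u))) ⟩
      sum (λ u → 𝟙 (S ∋ u) * d)                              ≡⟨ sum-*ʳ d (λ u → 𝟙 (S ∋ u)) ⟩
      sum (λ u → 𝟙 (S ∋ u)) * d                              ≡⟨ cong (_* d) (card-∑ S) ⟨
      ∣ S ∣ * d                                              ≡⟨ *-comm ∣ S ∣ d ⟩
      d * ∣ S ∣                                              ∎
      where
      open ≤-Reasoning
      f e : Fin n → Fin n → ℕ
      f u v = 𝟙 (S ∋ u) * 𝟙 (adj G u v ∧ μ u v)
      e u v = 𝟙 ((u <ᵇ v ∧ adj G u v) ∧ (S ∋ u ∧ S ∋ v))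
      diag : ∀ u → f u u ≡ 0
      diag u rewrite loopless G u = *-zeroʳ (𝟙 (S ∋ u))
      pointwise : ∀ u v → e u v ≤ 𝟙 (u <ᵇ v) * (f u v + f v u)
      pointwise u v rewrite symmetric G v u with u <ᵇ v | adj G u v in adj-uv | S ∋ u | S ∋ v
      ... | false | _     | _     | _     = z≤n
      ... | true  | false | _     | _     = z≤n
      ... | true  | true  | false | _     = z≤n
      ... | true  | true  | true  | false = z≤n
      ... | true  | true  | true  | true
        rewrite oriented u v (subst T (sym adj-uv) tt) with μ u v
      ...   | true  = ≤-refl
      ...   | false = ≤-refl

    arboricity≤2*outDegree : ∀ {d} → (∀ v → outDegree G μ v ≤ d) → arboricity G ≤ 2 * d
    arboricity≤2*outDegree {d} out≤d = maxOverSubsets≤ _ λ S → density≤ {d = d} ∣ S ∣ (numEdgesIn≤outDegree out≤d S)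

    degree-in-out : ∀ v → degree G v ≡ inDegree G μ v + outDegree G μ v
    degree-in-out v = begin
      degree G v                                                         ≡⟨ degree-∑ G v ⟩
      sum (λ u → 𝟙 (adj G v u))                                          ≡⟨ sum-cong-≗ pointwise ⟩
      sum (λ u → 𝟙 (adj G u v ∧ μ u v) + 𝟙 (adj G v u ∧ μ v u))          ≡⟨ ∑-distrib-+ (λ u → 𝟙 (adj G u v ∧ μ u v)) (λ u → 𝟙 (adj G v u ∧ μ v u)) ⟩
      _                                                                  ≡⟨ cong₂ _+_ (inDegree-∑ G μ v) (outDegree-∑ G μ v) ⟨
      inDegree G μ v + outDegree G μ v                                   ∎
      where
      open ≡-Reasoning
      pointwise : ∀ u → 𝟙 (adj G v u) ≡ 𝟙 (adj G u v ∧ μ u v) + 𝟙 (adj G v u ∧ μ v u)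
      pointwise u rewrite symmetric G u v with adj G v u in adj-vu
      ... | false = refl
      ... | true rewrite oriented v u (subst T (sym adj-vu) tt) with μ v u
      ...   | true  = refl
      ...   | false = refl

-- The forests-decomposition orientation

sum<n : (f : Fin n → ℕ) → (∀ i → f i ≤ 1) → ∀ i → f i ≡ 0 → sum f < n
sum<n {suc n} f f≤1 zero    f₀≡0 rewrite f₀≡0 =
  s≤s (≤-trans (sum≤n*c 1 (f≤1 ∘ suc)) (≤-reflexive (*-identityʳ n)))
sum<n {suc n} f f≤1 (suc i) fᵢ≡0 =
  +-mono-≤-< (f≤1 zero) (sum<n (f ∘ suc) (f≤1 ∘ suc) i fᵢ≡0)

-- Sums over a subset are kept as sums over all vertices with an indicator, so that one removal
-- identity, `weight-without`, serves both the size of a set and the running time of the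
-- elimination.
weight : Subset n → (Fin n → ℕ) → ℕ
weight A w = sum (λ u → 𝟙 (A ∋ u) * w u)

weight-without : ∀ {A : Subset n} {v} → v ∈ A → ∀ w → weight A w ≡ w v + weight (A without v) w
weight-without {A = inside ∷ A} here w =
  cong₂ _+_ (+-identityʳ (w zero)) (cong (λ B → weight B (w ∘ suc)) (sym (p─⊥≡p A)))
weight-without {A = inside ∷ A} {suc v} (there v∈A) w =
  trans (cong (1 * w zero +_) (weight-without v∈A (w ∘ suc)))
        (+-exchange (1 * w zero) (w (suc v)) (weight (A without v) (w ∘ suc)))
  where
  +-exchange : ∀ a b c → a + (b + c) ≡ b + (a + c)
  +-exchange = solve-∀
weight-without {A = outside ∷ A} (there v∈A) w = weight-without v∈A (w ∘ suc)

card≡weight : (A : Subset n) → ∣ A ∣ ≡ weight A (λ _ → 1)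
card≡weight A = trans (card-∑ A) (sum-cong-≗ (λ u → sym (*-identityʳ (𝟙 (A ∋ u)))))

card-without : ∀ {A : Subset n} {v} → v ∈ A → ∣ A ∣ ≡ suc ∣ A without v ∣
card-without {A = A} {v} v∈A = trans (card≡weight A)
  (trans (weight-without v∈A (λ _ → 1)) (cong suc (sym (card≡weight (A without v)))))

∉without : (A : Subset n) (v : Fin n) → v ∉ A without v
∉without (x ∷ A) (suc v) (there v∈) = ∉without A v v∈

without⊆ : (A : Subset n) {v u : Fin n} → u ∈ A without v → u ∈ A
without⊆ A {v} = p─q⊆p A ⁅ v ⁆

nonempty : ∀ {A : Subset n} {k} → ∣ A ∣ ≡ suc k → ∃ (_∈ A)
nonempty {n} {A} eq with nonempty? A
... | yes ne = ne
... | no ¬ne rewrite Empty-unique ¬ne | ∣⊥∣≡0 n = contradiction eq λ ()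

weight-≥ : (A : Subset n) (w : Fin n → ℕ) → ∀ {d} → (∀ u → u ∈ A → d ≤ w u) → ∣ A ∣ * d ≤ weight A w
weight-≥ A w {d} d≤w = begin
  ∣ A ∣ * d                       ≡⟨ cong (_* d) (card-∑ A) ⟩
  sum (λ u → 𝟙 (A ∋ u)) * d       ≡⟨ sum-*ʳ d (λ u → 𝟙 (A ∋ u)) ⟨
  weight A (λ _ → d)              ≤⟨ sum-mono-≤ pointwise ⟩
  weight A w                      ∎
  where
  open ≤-Reasoning
  pointwise : ∀ u → 𝟙 (A ∋ u) * d ≤ 𝟙 (A ∋ u) * w u
  pointwise u with u ∈? A
  ... | yes u∈A = *-monoʳ-≤ 1 (d≤w u u∈A)
  ... | no _    = z≤n

not-null⇒ : ∀ {A : Set} (xs : List A) → not (null xs) ≡ true → 1 ≤ length xs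
not-null⇒ (x ∷ xs) _ = s≤s z≤n

⇒not-null : ∀ {A : Set} (xs : List A) → 1 ≤ length xs → not (null xs) ≡ true
⇒not-null (x ∷ xs) _ = refl

time-ticks : ∀ t → time (CostMonad.ticks deterministic t) ≡ t
time-ticks zero    = refl
time-ticks (suc t) = cong suc (time-ticks t)

module _ (G : Graph n) where

  -- The summand at `u = v` vanishes, as there are no loops. Strictness is what makes `n` probes
  -- enough for `findMin` when it starts at bucket 0.
  degreeIn<n : ∀ A v → degreeIn G A v < n
  degreeIn<n A v rewrite degreeIn-∑ G A v =
    sum<n _ (λ u → 𝟙≤1 (adj G v u ∧ A ∋ u)) v (cong (λ b → 𝟙 (b ∧ A ∋ v)) (loopless G v))

  degreeIn≤card : ∀ A v → degreeIn G A v ≤ ∣ A ∣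
  degreeIn≤card A v rewrite degreeIn-∑ G A v | card-∑ A =
    sum-mono-≤ (λ u → 𝟙-mono {adj G v u ∧ A ∋ u} (proj₂ ∘ ∧-elim {adj G v u}))

  IsMin : Subset n → Fin n → Set
  IsMin A v = v ∈ A × (∀ u → u ∈ A → degreeIn G A v ≤ degreeIn G A u)

  -- The average degree in G[A] is below twice the arboricity.
  minDegree≤2*arboricity : 1 ≤ arboricity G → ∀ A v → IsMin A v → degreeIn G A v ≤ 2 * arboricity G
  minDegree≤2*arboricity 1≤α A v (v∈A , least) with ∣ A ∣ in size
  ... | zero        = contradiction (trans (sym size) (card-without v∈A)) λ ()
  -- Singletons have density 0, so the arboricity says nothing about them; the crude degree bound 1
  -- is enough once the arboricity is positive.
  ... | suc zero    = begin
    degreeIn G A v      ≤⟨ degreeIn≤card A v ⟩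
    ∣ A ∣               ≡⟨ size ⟩
    1                   ≤⟨ 1≤α ⟩
    arboricity G        ≤⟨ m≤m+n _ _ ⟩
    2 * arboricity G    ∎
    where open ≤-Reasoning
  ... | suc (suc k) = *-cancelˡ-≤ (2 + k) (begin
    (2 + k) * degreeIn G A v       ≡⟨ cong (_* degreeIn G A v) size ⟨
    ∣ A ∣ * degreeIn G A v         ≤⟨ weight-≥ A (degreeIn G A) least ⟩
    weight A (degreeIn G A)        ≤⟨ sum-degreeIn≤ G A ⟩
    2 * numEdgesIn G A             ≤⟨ *-monoʳ-≤ 2 (numEdgesIn≤arboricity G A size) ⟩
    2 * (arboricity G * suc k)     ≤⟨ *-monoʳ-≤ 2 (*-monoʳ-≤ (arboricity G) (n≤1+n (suc k))) ⟩
    2 * (arboricity G * (2 + k))   ≡⟨ arith (arboricity G) (2 + k) ⟩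
    (2 + k) * (2 * arboricity G)   ∎)
    where
    open ≤-Reasoning
    arith : ∀ a b → 2 * (a * b) ≡ b * (2 * a)
    arith = solve-∀

  -- Since `k + ps` stays constant, the vertex `w` guarantees a hit before the probes run out, and
  -- the hit `v` is a minimum because no degree lies below the current `k`. Measuring `time + k`
  -- makes the induction uniform: one tick for each bucket up to the degree of `v`.
  findMin-correct : ∀ ps A k {w} → w ∈ A → degreeIn G A w < k + ps →
    (∀ u → u ∈ A → k ≤ degreeIn G A u) →
    ∃ λ v → value (findMin G ps A k) ≡ just v × IsMin A v ×
            time (findMin G ps A k) + k ≤ suc (degreeIn G A v)
  findMin-correct zero A k {w} w∈A d<k k≤d =
    contradiction (k≤d w w∈A) (<⇒≱ (subst (degreeIn G A w <_) (+-identityʳ k) d<k))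
  findMin-correct (suc ps) A k {w} w∈A d<k+ps k≤d
    with Fin.any? (λ v → (v ∈? A) ×-dec (degreeIn G A v ≟ k))
  ... | yes (v , v∈A , refl) = v , refl , (v∈A , k≤d) , ≤-refl
  ... | no ∄k
    with v , found , least , t≤ ← findMin-correct ps A (suc k) w∈A
                       (subst (degreeIn G A w <_) (+-suc k ps) d<k+ps)
                       (λ u u∈A → ≤∧≢⇒< (k≤d u u∈A) (λ k≡d → ∄k (u , u∈A , sym k≡d)))
    = v , found , least , subst (_≤ suc (degreeIn G A v)) (+-suc _ k) t≤

  module _ {v u : Fin n} {μ : Orientation n} where

    orient-forward : orient G v u μ v u ≡ true
    orient-forward rewrite dec-true (v Fin.≟ v) refl | dec-true (u Fin.≟ u) refl = refl

    orient-backward : u ≢ v → orient G v u μ u v ≡ false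
    orient-backward u≢v rewrite dec-false (u Fin.≟ v) u≢v
      | dec-true (v Fin.≟ v) refl | dec-true (u Fin.≟ u) refl = refl

    orient-other : ∀ {x y} → ¬ (x ≡ v × y ≡ u) → ¬ (x ≡ u × y ≡ v) → orient G v u μ x y ≡ μ x y
    orient-other {x} {y} ¬vu ¬uv with x Fin.≟ v | y Fin.≟ u | x Fin.≟ u | y Fin.≟ v
    ... | yes x≡v | yes y≡u | _       | _       = contradiction (x≡v , y≡u) ¬vu
    ... | yes _   | no _    | yes x≡u | yes y≡v = contradiction (x≡u , y≡v) ¬uv
    ... | yes _   | no _    | yes _   | no _    = refl
    ... | yes _   | no _    | no _    | _       = refl
    ... | no _    | _       | yes x≡u | yes y≡v = contradiction (x≡u , y≡v) ¬uv
    ... | no _    | _       | yes _   | no _    = refl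
    ... | no _    | _       | no _    | _       = refl

  module _ (v : Fin n) (A : Subset n) where

    time-orientAll : ∀ us μ → time (orientAll G v A us μ) ≡ length us
    time-orientAll []       μ = refl
    time-orientAll (u ∷ us) μ = cong suc (time-orientAll us _)

    orientAll-other : ∀ {x y} → (∀ u → u ∈ A → ¬ (x ≡ v × y ≡ u) × ¬ (x ≡ u × y ≡ v)) →
      ∀ us μ → value (orientAll G v A us μ) x y ≡ μ x y
    orientAll-other other []       μ = refl
    orientAll-other other (u ∷ us) μ with u ∈? A
    ... | yes u∈A = trans (orientAll-other other us (orient G v u μ))
                          (orient-other {μ = μ} (proj₁ (other u u∈A)) (proj₂ (other u u∈A)))
    ... | no _    = orientAll-other other us μ

    -- The disjunction is the loop invariant: the pair is set already, or its entry is still to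
    -- come. A later entry either is `u` again and sets the same value, or leaves the pair alone.
    orientAll-forward : ∀ {u} → u ≢ v → ∀ us μ → μ v u ≡ true ⊎ (u ∈ˡ us × u ∈ A) →
      value (orientAll G v A us μ) v u ≡ true
    orientAll-forward u≢v [] μ (inj₁ set) = set
    orientAll-forward {u} u≢v (u′ ∷ us) μ hyp with u′ ∈? A | hyp
    ... | no _     | inj₁ set                = orientAll-forward u≢v us μ (inj₁ set)
    ... | no u∉A   | inj₂ (here refl , u∈A)  = contradiction u∈A u∉A
    ... | no _     | inj₂ (there u∈us , u∈A) = orientAll-forward u≢v us μ (inj₂ (u∈us , u∈A))
    ... | yes _    | inj₂ (there u∈us , u∈A) = orientAll-forward u≢v us _ (inj₂ (u∈us , u∈A))
    ... | yes _    | inj₂ (here refl , _)    = orientAll-forward u≢v us _ (inj₁ (orient-forward {v} {u} {μ}))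
    ... | yes _    | inj₁ set with u Fin.≟ u′
    ...   | yes refl = orientAll-forward u≢v us _ (inj₁ (orient-forward {v} {u} {μ}))
    ...   | no u≢u′  = orientAll-forward u≢v us _
                         (inj₁ (trans (orient-other {μ = μ} (u≢u′ ∘ proj₂) (u≢v ∘ proj₂)) set))

    orientAll-backward : ∀ {u} → u ≢ v → ∀ us μ → μ u v ≡ false ⊎ (u ∈ˡ us × u ∈ A) →
      value (orientAll G v A us μ) u v ≡ false
    orientAll-backward u≢v [] μ (inj₁ set) = set
    orientAll-backward {u} u≢v (u′ ∷ us) μ hyp with u′ ∈? A | hyp
    ... | no _     | inj₁ set                = orientAll-backward u≢v us μ (inj₁ set)
    ... | no u∉A   | inj₂ (here refl , u∈A)  = contradiction u∈A u∉A
    ... | no _     | inj₂ (there u∈us , u∈A) = orientAll-backward u≢v us μ (inj₂ (u∈us , u∈A))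
    ... | yes _    | inj₂ (there u∈us , u∈A) = orientAll-backward u≢v us _ (inj₂ (u∈us , u∈A))
    ... | yes _    | inj₂ (here refl , _)    = orientAll-backward u≢v us _ (inj₁ (orient-backward {μ = μ} u≢v))
    ... | yes _    | inj₁ set with u Fin.≟ u′
    ...   | yes refl = orientAll-backward u≢v us _ (inj₁ (orient-backward {μ = μ} u≢v))
    ...   | no u≢u′  = orientAll-backward u≢v us _
                         (inj₁ (trans (orient-other {μ = μ} (u≢v ∘ proj₁) (u≢u′ ∘ proj₁)) set))

  -- What the rounds from active set `A` onwards achieve, turning `μ` into `μ′`. Arcs set in earlier
  -- rounds have an end outside `A`, so `frame` keeps them for good. `out≤` counts heads in `A`
  -- only: edges between `x` and vertices removed earlier are already oriented into `x`.
  record Eliminated (A : Subset n) (d : ℕ) (μ μ′ : Orientation n) : Set where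
    field
      frame    : ∀ x y → x ∉ A ⊎ y ∉ A → μ′ x y ≡ μ x y
      oriented : ∀ x y → x ∈ A → y ∈ A → Edge G x y → μ′ y x ≡ not (μ′ x y)
      out≤     : ∀ x → x ∈ A → sum (λ u → 𝟙 (adj G x u ∧ (A ∋ u ∧ μ′ x u))) ≤ d

  open Eliminated

  module _ {A : Subset n} {d : ℕ} {v : Fin n} (v∈A : v ∈ A) (dv≤d : degreeIn G A v ≤ d)
           (μ : Orientation n) where

    private
      μ₁ : Orientation n
      μ₁ = value (orientAll G v A (neighbours G v) μ)

      neighbour : ∀ {u} → Edge G v u → u ∈ˡ neighbours G v
      neighbour {u} e = ∈-filter⁺ (λ u → T? (adj G v u)) (∈-allFin u) e

      edge≢ : ∀ {u} → Edge G v u → u ≢ v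
      edge≢ e refl = no-loop G e

      forward : ∀ {u} → u ∈ A → Edge G v u → μ₁ v u ≡ true
      forward u∈A e = orientAll-forward v A (edge≢ e) (neighbours G v) μ (inj₂ (neighbour e , u∈A))

      backward : ∀ {u} → u ∈ A → Edge G v u → μ₁ u v ≡ false
      backward u∈A e = orientAll-backward v A (edge≢ e) (neighbours G v) μ (inj₂ (neighbour e , u∈A))

    -- The arcs set at `v` in this round survive by `frame`, as `v` has left the set. They all leave
    -- `v`: hence `degreeIn G A v` bounds its out-degree within `A`, and dropping `v` hides no arc
    -- that leaves another vertex.
    eliminated-step : ∀ {μ′} → Eliminated (A without v) d μ₁ μ′ → Eliminated A d μ μ′
    eliminated-step {μ′} E = record { frame = fr ; oriented = or ; out≤ = out }
      where
      v∉ : v ∉ A without v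
      v∉ = ∉without A v

      fr : ∀ x y → x ∉ A ⊎ y ∉ A → μ′ x y ≡ μ x y
      fr x y ∉A = trans
        (frame E x y ([ (λ x∉A → inj₁ (x∉A ∘ without⊆ A)) , (λ y∉A → inj₂ (y∉A ∘ without⊆ A)) ]′ ∉A))
        (orientAll-other v A other (neighbours G v) μ)
        where
        other : ∀ u → u ∈ A → ¬ (x ≡ v × y ≡ u) × ¬ (x ≡ u × y ≡ v)
        other u u∈A =
          (λ { (refl , refl) → [ (λ x∉A → x∉A v∈A) , (λ y∉A → y∉A u∈A) ]′ ∉A }) ,
          (λ { (refl , refl) → [ (λ x∉A → x∉A u∈A) , (λ y∉A → y∉A v∈A) ]′ ∉A })

      or : ∀ x y → x ∈ A → y ∈ A → Edge G x y → μ′ y x ≡ not (μ′ x y)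
      or x y x∈A y∈A e with x Fin.≟ v | y Fin.≟ v
      ... | yes refl | _ rewrite frame E v y (inj₁ v∉) | frame E y v (inj₂ v∉)
                               | forward y∈A e | backward y∈A e = refl
      ... | no _ | yes refl rewrite frame E v x (inj₁ v∉) | frame E x v (inj₂ v∉)
                               | forward x∈A (adj-sym G e) | backward x∈A (adj-sym G e) = refl
      ... | no x≢v | no y≢v = oriented E x y (x∈p∧x≢y⇒x∈p-y x∈A x≢v) (x∈p∧x≢y⇒x∈p-y y∈A y≢v) e

      out : ∀ x → x ∈ A → sum (λ u → 𝟙 (adj G x u ∧ (A ∋ u ∧ μ′ x u))) ≤ d
      out x x∈A with x Fin.≟ v
      ... | yes refl = ≤-trans (sum-mono-≤ pointwise) (≤-trans (≤-reflexive (sym (degreeIn-∑ G A v))) dv≤d)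
        where
        pointwise : ∀ u → 𝟙 (adj G v u ∧ (A ∋ u ∧ μ′ v u)) ≤ 𝟙 (adj G v u ∧ A ∋ u)
        pointwise u = 𝟙-mono {adj G v u ∧ (A ∋ u ∧ μ′ v u)} λ t →
          let e , t′ = ∧-elim {adj G v u} t in ∧-intro e (proj₁ (∧-elim {A ∋ u} t′))
      ... | no x≢v = ≤-trans (sum-mono-≤ pointwise) (out≤ E x (x∈p∧x≢y⇒x∈p-y x∈A x≢v))
        where
        pointwise : ∀ u → 𝟙 (adj G x u ∧ (A ∋ u ∧ μ′ x u)) ≤ 𝟙 (adj G x u ∧ ((A without v) ∋ u ∧ μ′ x u))
        pointwise u = 𝟙-mono {adj G x u ∧ (A ∋ u ∧ μ′ x u)} λ t →
          let e , t′   = ∧-elim {adj G x u} t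
              u∈ , t″ = ∧-elim {A ∋ u} t′
              u∈A      = does⇒ (u ∈? A) u∈
              -- An arc from `x` to `v` would contradict `backward`: this round oriented that edge
              -- out of `v`.
              u≢v : u ≢ v
              u≢v = λ { refl → subst T (trans (frame E x v (inj₂ v∉)) (backward x∈A (adj-sym G e))) t″ }
          in ∧-intro e (∧-intro (⇒does (u ∈? (A without v)) (x∈p∧x≢y⇒x∈p-y u∈A u≢v)) t″)

  module _ {d : ℕ} (min≤d : ∀ A v → IsMin A v → degreeIn G A v ≤ d) where

    eliminate-correct : ∀ rs A μ → ∣ A ∣ ≡ rs → Eliminated A d μ (value (eliminate G rs A μ))
    -- Each round is charged to the vertex it removes: probing from bucket 0 up to a minimum degree
    -- costs at most 1 plus the degree of that vertex, and scanning its neighbours costs the degree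
    -- again. So restarting every search at bucket 0 is affordable.
    eliminate-time    : ∀ rs A μ → ∣ A ∣ ≡ rs →
      time (eliminate G rs A μ) ≤ weight A (λ v → 1 + 2 * degree G v)

    eliminate-correct zero A μ size = record
      { frame    = λ x y _ → refl
      ; oriented = λ x y x∈A → contradiction (trans (sym size) (card-without x∈A)) λ ()
      ; out≤     = λ x x∈A → contradiction (trans (sym size) (card-without x∈A)) λ ()
      }
    eliminate-correct (suc rs) A μ size
      with w , w∈A ← nonempty {A = A} size
      with v , found , min , t≤ ← findMin-correct n A 0 w∈A (degreeIn<n A w) (λ _ _ → z≤n)
      rewrite found =
      eliminated-step (proj₁ min) (min≤d A v min) μ
        (eliminate-correct rs (A without v) _ (suc-injective (trans (sym (card-without (proj₁ min))) size)))

    eliminate-time zero A μ size = z≤n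
    eliminate-time (suc rs) A μ size
      with w , w∈A ← nonempty {A = A} size
      with v , found , min , t≤ ← findMin-correct n A 0 w∈A (degreeIn<n A w) (λ _ _ → z≤n)
      rewrite found = begin
      tf + (to + te)                             ≤⟨ +-mono-≤ tf≤ (+-mono-≤ to≤ te≤) ⟩
      suc dv + (dv + weight (A without v) cost)  ≡⟨ arith dv (weight (A without v) cost) ⟩
      cost v + weight (A without v) cost         ≡⟨ weight-without (proj₁ min) cost ⟨
      weight A cost                              ∎
      where
      open ≤-Reasoning
      cost : Fin n → ℕ
      cost v = 1 + 2 * degree G v
      dv = degree G v
      μ₁ = value (orientAll G v A (neighbours G v) μ)
      tf = time (findMin G n A 0)
      to = time (orientAll G v A (neighbours G v) μ)
      te = time (eliminate G rs (A without v) μ₁)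
      tf≤ : tf ≤ suc dv
      tf≤ = ≤-trans (subst (_≤ suc (degreeIn G A v)) (+-identityʳ tf) t≤)
                    (s≤s (List.length-filter (_∈? A) (neighbours G v)))
      to≤ : to ≤ dv
      to≤ = ≤-reflexive (time-orientAll v A (neighbours G v) μ)
      te≤ : te ≤ weight (A without v) cost
      te≤ = eliminate-time rs (A without v) μ₁ (suc-injective (trans (sym (card-without (proj₁ min))) size))
      arith : ∀ a w → suc a + (a + w) ≡ (1 + 2 * a) + w
      arith = solve-∀

  nonIsolated⇒degree : ∀ {v} → v ∈ nonIsolated G → 1 ≤ degree G v
  nonIsolated⇒degree {v} v∈ = not-null⇒ (neighbours G v)
    (trans (sym (lookup∘tabulate _ v)) ([]=⇒lookup v∈))

  edge⇒nonIsolated : ∀ {u v} → Edge G u v → u ∈ nonIsolated G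
  edge⇒nonIsolated {u} {v} e = lookup⇒[]= u _ (trans (lookup∘tabulate _ u)
    (⇒not-null (neighbours G u) (begin
      1                         ≡⟨ cong 𝟙 (T⇒≡true e) ⟨
      𝟙 (adj G u v)             ≤⟨ term≤sum (λ v → 𝟙 (adj G u v)) v ⟩
      sum (λ v → 𝟙 (adj G u v)) ≡⟨ degree-∑ G u ⟨
      degree G u                ∎)))
    where open ≤-Reasoning

  module _ (1≤α : 1 ≤ arboricity G) where

    private
      μ : Orientation n
      μ = value (forestsDecompositionOrientation G)

      elim : Eliminated (nonIsolated G) (2 * arboricity G) (λ _ _ → false) μ
      elim = eliminate-correct (minDegree≤2*arboricity 1≤α) ∣ nonIsolated G ∣ (nonIsolated G) _ refl

    forestsDecomposition-orients : IsOrientation G μ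
    forestsDecomposition-orients u v e =
      oriented elim u v (edge⇒nonIsolated e) (edge⇒nonIsolated (adj-sym G e)) e

    forestsDecomposition-outDegree : ∀ v → outDegree G μ v ≤ 2 * arboricity G
    forestsDecomposition-outDegree v rewrite outDegree-∑ G μ v with v ∈? nonIsolated G
    ... | yes v∈ = ≤-trans (sum-mono-≤ pointwise) (out≤ elim v v∈)
      where
      -- Every neighbour is itself non-isolated, so the restriction to heads in the initial set
      -- excludes nothing.
      pointwise : ∀ u → 𝟙 (adj G v u ∧ μ v u) ≤ 𝟙 (adj G v u ∧ (nonIsolated G ∋ u ∧ μ v u))
      pointwise u = 𝟙-mono {adj G v u ∧ μ v u} λ t →
        let e , t′ = ∧-elim {adj G v u} t in
        ∧-intro e (∧-intro (⇒does (u ∈? nonIsolated G) (edge⇒nonIsolated (adj-sym G e))) t′)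
    ... | no v∉ = ≤-trans (sum≤n*c 0 pointwise) (subst (_≤ 2 * arboricity G) (sym (*-zeroʳ n)) z≤n)
      where
      pointwise : ∀ u → 𝟙 (adj G v u ∧ μ v u) ≤ 0
      pointwise u = ≤-reflexive (𝟙-false {adj G v u ∧ μ v u} λ t → v∉ (edge⇒nonIsolated (proj₁ (∧-elim {adj G v u} t))))

    forestsDecomposition-time : time (forestsDecompositionOrientation G) ≤ 8 * numEdges G
    forestsDecomposition-time = begin
      time (CostMonad.ticks deterministic (2 * m)) + te       ≡⟨ cong (_+ te) (time-ticks (2 * m)) ⟩
      2 * m + te                                              ≤⟨ +-monoʳ-≤ (2 * m) (eliminate-time (minDegree≤2*arboricity 1≤α) ∣ A ∣ A _ refl) ⟩
      2 * m + weight A (λ v → 1 + 2 * degree G v)             ≤⟨ +-monoʳ-≤ (2 * m) (sum-mono-≤ pointwise) ⟩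
      2 * m + sum (λ v → 3 * degree G v)                      ≡⟨ cong (2 * m +_) (sum-*ˡ 3 (degree G)) ⟩
      2 * m + 3 * sum (degree G)                              ≤⟨ +-monoʳ-≤ (2 * m) (*-monoʳ-≤ 3 (sum-degree≤ G)) ⟩
      2 * m + 3 * (2 * m)                                     ≡⟨ arith m ⟩
      8 * m                                                   ∎
      where
      open ≤-Reasoning
      m = numEdges G
      A = nonIsolated G
      te = time (eliminate G ∣ A ∣ A (λ _ _ → false))
      arith : ∀ m → 2 * m + 3 * (2 * m) ≡ 8 * m
      arith = solve-∀
      arith′ : ∀ d → d + 2 * d ≡ 3 * d
      arith′ = solve-∀
      -- A non-isolated vertex pays the constant of its round with its own degree, which keeps the
      -- total linear in the edges instead of the vertices.
      pointwise : ∀ v → 𝟙 (A ∋ v) * (1 + 2 * degree G v) ≤ 3 * degree G v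
      pointwise v with v ∈? A
      ... | yes v∈ = begin
        1 * (1 + 2 * degree G v)      ≡⟨ *-identityˡ (1 + 2 * degree G v) ⟩
        1 + 2 * degree G v            ≤⟨ +-monoˡ-≤ (2 * degree G v) (nonIsolated⇒degree v∈) ⟩
        degree G v + 2 * degree G v   ≡⟨ arith′ (degree G v) ⟩
        3 * degree G v                ∎
      ... | no _ = z≤n

-- Expected running time

-- `ℚ./` reduces fractions, so identities are proved for unnormalised rationals, where equality is
-- cross-multiplication.
toℚᵘ-/ : ∀ a d → ℚ.toℚᵘ (ℤ.+ a ℚ./ suc d) ℚᵘ.≃ mkℚᵘ (ℤ.+ a) d
toℚᵘ-/ a d = ℚ.toℚᵘ-fromℚᵘ (mkℚᵘ (ℤ.+ a) d)

fromℕ≤/ : ∀ {a b} d .{{_ : NonZero d}} → a * d ≤ b → fromℕ a ℚ.≤ ℤ.+ b ℚ./ d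
fromℕ≤/ {a} {b} (suc d) ad≤b = ℚ.toℚᵘ-cancel-≤ (begin
  ℚ.toℚᵘ (fromℕ a)              ≃⟨ toℚᵘ-/ a 0 ⟩
  mkℚᵘ (ℤ.+ a) 0                ≤⟨ *≤* (subst₂ ℤ._≤_ (ℤ.pos-* a (suc d)) (sym (ℤ.*-identityʳ (ℤ.+ b))) (ℤ.+≤+ ad≤b)) ⟩
  mkℚᵘ (ℤ.+ b) d                ≃⟨ toℚᵘ-/ b d ⟨
  ℚ.toℚᵘ (ℤ.+ b ℚ./ suc d)      ∎)
  where open ℚᵘ.≤-Reasoning

fromℕ-mono-≤ : ∀ {a b} → a ≤ b → fromℕ a ℚ.≤ fromℕ b
fromℕ-mono-≤ {a} a≤b = fromℕ≤/ {a} 1 (≤-trans (≤-reflexive (*-identityʳ a)) a≤b)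

fromℕ-+ : ∀ a b → fromℕ (a + b) ≡ fromℕ a ℚ.+ fromℕ b
fromℕ-+ a b = ℚ.toℚᵘ-injective (begin-equality
  ℚ.toℚᵘ (fromℕ (a + b))                    ≃⟨ toℚᵘ-/ (a + b) 0 ⟩
  mkℚᵘ (ℤ.+ (a + b)) 0                      ≃⟨ *≡* (cong (ℤ._* ℤ.1ℤ) (cong₂ ℤ._+_ (sym (ℤ.*-identityʳ (ℤ.+ a))) (sym (ℤ.*-identityʳ (ℤ.+ b))))) ⟩
  mkℚᵘ (ℤ.+ a) 0 ℚᵘ.+ mkℚᵘ (ℤ.+ b) 0        ≃⟨ ℚᵘ.+-cong (toℚᵘ-/ a 0) (toℚᵘ-/ b 0) ⟨
  ℚ.toℚᵘ (fromℕ a) ℚᵘ.+ ℚ.toℚᵘ (fromℕ b)    ≃⟨ ℚ.toℚᵘ-homo-+ (fromℕ a) (fromℕ b) ⟨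
  ℚ.toℚᵘ (fromℕ a ℚ.+ fromℕ b)              ∎)
  where open ℚᵘ.≤-Reasoning

fromℕ-*-inverse : ∀ k → fromℕ (suc k) ℚ.* (ℤ.+ 1 ℚ./ suc k) ≡ 1ℚ
fromℕ-*-inverse k = ℚ.toℚᵘ-injective (begin-equality
  ℚ.toℚᵘ (fromℕ (suc k) ℚ.* (ℤ.+ 1 ℚ./ suc k))              ≃⟨ ℚ.toℚᵘ-homo-* (fromℕ (suc k)) (ℤ.+ 1 ℚ./ suc k) ⟩
  ℚ.toℚᵘ (fromℕ (suc k)) ℚᵘ.* ℚ.toℚᵘ (ℤ.+ 1 ℚ./ suc k)      ≃⟨ ℚᵘ.*-cong (toℚᵘ-/ (suc k) 0) (toℚᵘ-/ 1 k) ⟩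
  mkℚᵘ (ℤ.+ suc k) 0 ℚᵘ.* mkℚᵘ (ℤ.+ 1) k                    ≃⟨ *≡* (cong ℤ.+_ (cong suc (trans (*-identityʳ _) (trans (*-identityʳ k) (sym (trans (+-identityʳ _) (+-identityʳ k))))))) ⟩
  ℚ.toℚᵘ 1ℚ                                                 ∎)
  where open ℚᵘ.≤-Reasoning

sumℚ-mono-≤ : ∀ {k} {f g : Fin k → ℚ} → (∀ i → f i ℚ.≤ g i) → ∑ℚ.sum f ℚ.≤ ∑ℚ.sum g
sumℚ-mono-≤ {zero}  f≤g = ℚ.≤-refl
sumℚ-mono-≤ {suc k} f≤g = ℚ.+-mono-≤ (f≤g zero) (sumℚ-mono-≤ (f≤g ∘ suc))

sumℚ-const : ∀ k b → ∑ℚ.sum {k} (λ _ → b) ≡ fromℕ k ℚ.* b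
sumℚ-const zero    b = sym (ℚ.*-zeroˡ b)
sumℚ-const (suc k) b = begin
  b ℚ.+ ∑ℚ.sum {k} (λ _ → b)         ≡⟨ cong₂ ℚ._+_ (sym (ℚ.*-identityˡ b)) (sumℚ-const k b) ⟩
  1ℚ ℚ.* b ℚ.+ fromℕ k ℚ.* b         ≡⟨ ℚ.*-distribʳ-+ b 1ℚ (fromℕ k) ⟨
  (fromℕ 1 ℚ.+ fromℕ k) ℚ.* b        ≡⟨ cong (ℚ._* b) (fromℕ-+ 1 k) ⟨
  fromℕ (suc k) ℚ.* b                ∎
  where open ≡-Reasoning

mean : ∀ {k} → (Fin (suc k) → ℚ) → ℚ
mean {k} f = ∑ℚ.sum f ℚ.* (ℤ.+ 1 ℚ./ suc k)

mean-mono-≤ : ∀ {k} {f g : Fin (suc k) → ℚ} → (∀ i → f i ℚ.≤ g i) → mean f ℚ.≤ mean g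
mean-mono-≤ {k} f≤g =
  ℚ.*-monoʳ-≤-nonNeg (ℤ.+ 1 ℚ./ suc k) {{ℚ.normalize-nonNeg 1 (suc k)}} (sumℚ-mono-≤ f≤g)

mean-shift : ∀ {k} (f : Fin (suc k) → ℚ) b → mean (λ i → f i ℚ.+ b) ≡ mean f ℚ.+ b
mean-shift {k} f b = begin
  ∑ℚ.sum (λ i → f i ℚ.+ b) ℚ.* r                       ≡⟨ cong (ℚ._* r) (∑ℚ.∑-distrib-+ f (λ _ → b)) ⟩
  (∑ℚ.sum f ℚ.+ ∑ℚ.sum {suc k} (λ _ → b)) ℚ.* r        ≡⟨ ℚ.*-distribʳ-+ r (∑ℚ.sum f) _ ⟩
  mean f ℚ.+ ∑ℚ.sum {suc k} (λ _ → b) ℚ.* r            ≡⟨ cong (λ s → mean f ℚ.+ s ℚ.* r) (trans (sumℚ-const (suc k) b) (ℚ.*-comm (fromℕ (suc k)) b)) ⟩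
  mean f ℚ.+ b ℚ.* fromℕ (suc k) ℚ.* r                 ≡⟨ cong (mean f ℚ.+_) (ℚ.*-assoc b (fromℕ (suc k)) r) ⟩
  mean f ℚ.+ b ℚ.* (fromℕ (suc k) ℚ.* r)               ≡⟨ cong (λ s → mean f ℚ.+ b ℚ.* s) (fromℕ-*-inverse k) ⟩
  mean f ℚ.+ b ℚ.* 1ℚ                                  ≡⟨ cong (mean f ℚ.+_) (ℚ.*-identityʳ b) ⟩
  mean f ℚ.+ b                                         ∎
  where
  open ≡-Reasoning
  r = ℤ.+ 1 ℚ./ suc k

module _ {A B : Set} (p : Rand A) (f : A → Rand B) where

  outputs₂ : ∀ {a s b} → Outputs (bindRand p f) (inj₂ (a , s)) b → Outputs (f a) s b
  outputs₂ {a} {s} (halt eq) with Rand.step (f a) s in step≡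
  outputs₂ (halt refl) | inj₁ b = halt step≡
  outputs₂ {a} {s} (draw eq i o) with Rand.step (f a) s in step≡
  outputs₂ (draw refl i o) | inj₂ (k , g) = draw step≡ i (outputs₂ o)

  outputs-bind : ∀ {s b} → Outputs (bindRand p f) (inj₁ s) b →
    ∃ λ a → Outputs p s a × MayOutput (f a) b
  outputs-bind {s} o with Rand.step p s in step≡
  -- When `p` halts, `bindStep` takes the first step of `f a` at once, so what remains is a run from
  -- `inj₂ (a , start)`.
  outputs-bind {s} (halt eq) | inj₁ a rewrite step≡ = a , halt step≡ , outputs₂ (halt eq)
  outputs-bind {s} (draw eq i o) | inj₁ a rewrite step≡ = a , halt step≡ , outputs₂ (draw eq i o)
  outputs-bind {s} (halt eq) | inj₂ (k , g) rewrite step≡ = contradiction eq λ ()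
  outputs-bind {s} (draw eq i o) | inj₂ (k , g) rewrite step≡ with refl ← eq
    with a , oa , ob ← outputs-bind o = a , draw step≡ i oa , ob

  truncated₂ : ∀ t a s → truncatedExpectation (bindRand p f) t (inj₂ (a , s)) ≡
                         truncatedExpectation (f a) t s
  truncated₂ zero    a s = refl
  truncated₂ (suc t) a s with Rand.step (f a) s
  ... | inj₁ b       = refl
  ... | inj₂ (k , g) = cong (λ x → 1ℚ ℚ.+ x ℚ.* (ℤ.+ 1 ℚ./ suc k)) (∑ℚ.sum-cong-≗ (λ i → truncated₂ t a (g i)))

  -- Induction on the truncation, which may be kept the same on both sides because min(t, X + Y) ≤
  -- min(t, X) + Y. As `b` bounds the second run whatever the first one outputs, it passes through
  -- the mean as a constant. The hypothesis covers only outputs possible from `s`; an output of a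
  -- successor of `s` is one of them.
  truncated-bind : ∀ {b} → 0ℚ ℚ.≤ b → ∀ t s →
    (∀ a → Outputs p s a → ExpectedTime≤ (f a) b) →
    truncatedExpectation (bindRand p f) t (inj₁ s) ℚ.≤ truncatedExpectation p t s ℚ.+ b
  truncated-bind {b} 0≤b zero s bound = ℚ.≤-trans 0≤b (ℚ.≤-reflexive (sym (ℚ.+-identityˡ b)))
  truncated-bind {b} 0≤b (suc t) s bound with Rand.step p s in step≡
  ... | inj₁ a = begin
    _   ≡⟨ truncated₂ (suc t) a (Rand.start (f a)) ⟩
    truncatedExpectation (f a) (suc t) (Rand.start (f a)) ≤⟨ bound a (halt step≡) (suc t) ⟩
    b   ≡⟨ ℚ.+-identityˡ b ⟨
    0ℚ ℚ.+ b ∎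
    where open ℚ.≤-Reasoning
  ... | inj₂ (k , g) = begin
    1ℚ ℚ.+ mean (λ i → truncatedExpectation (bindRand p f) t (inj₁ (g i)))
      ≤⟨ ℚ.+-monoʳ-≤ 1ℚ (mean-mono-≤ (λ i → truncated-bind 0≤b t (g i) (λ a o → bound a (draw step≡ i o)))) ⟩
    1ℚ ℚ.+ mean (λ i → truncatedExpectation p t (g i) ℚ.+ b)
      ≡⟨ cong (1ℚ ℚ.+_) (mean-shift (λ i → truncatedExpectation p t (g i)) b) ⟩
    1ℚ ℚ.+ (mean (λ i → truncatedExpectation p t (g i)) ℚ.+ b)
      ≡⟨ ℚ.+-assoc 1ℚ (mean (λ i → truncatedExpectation p t (g i))) b ⟨
    1ℚ ℚ.+ mean (λ i → truncatedExpectation p t (g i)) ℚ.+ b ∎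
    where open ℚ.≤-Reasoning

-- Spec p P t: all outputs of p satisfy P and the (expected) running time of p
-- is at most t.
record CostLogic {ℓ} (𝓜 : CostMonad ℓ) : Set (lsuc 0ℓ Level.⊔ ℓ) where
  open CostMonad 𝓜
  field
    Spec         : {A : Set} → M A → (A → Set) → ℕ → Set
    spec-return  : ∀ {A} {P : A → Set} {a} → P a → Spec (return a) P 0
    spec-tick    : Spec tick (λ _ → ⊤) 1
    spec-bind    : ∀ {A B} {p : M A} {f : A → M B} {P Q s t} →
                   Spec p P s → (∀ a → P a → Spec (f a) Q t) → Spec (p >>= f) Q (s + t)
    spec-weaken  : ∀ {A} {p : M A} {P Q : A → Set} {s t} →
                   (∀ a → P a → Q a) → s ≤ t → Spec p P s → Spec p Q t

  spec-ticks : ∀ t → Spec (ticks t) (λ _ → ⊤) t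
  spec-ticks zero    = spec-return tt
  spec-ticks (suc t) = spec-bind spec-tick (λ _ _ → spec-ticks t)

  spec-liftTimed : ∀ {A} (p : Timed A) {P : A → Set} → P (value p) → Spec (liftTimed 𝓜 p) P (time p)
  spec-liftTimed p Pp = spec-weaken (λ _ Pa → Pa) (≤-reflexive (+-identityʳ (time p)))
    (spec-bind (spec-ticks (time p)) (λ _ _ → spec-return Pp))

deterministicLogic : CostLogic deterministic
deterministicLogic = record
  { Spec        = λ p P t → P (value p) × time p ≤ t
  ; spec-return = λ Pa → Pa , z≤n
  ; spec-tick   = tt , ≤-refl
  ; spec-bind   = λ { {p = p} (Pp , s≤) q → let Qf , t≤ = q (value p) Pp in Qf , +-mono-≤ s≤ t≤ }
  ; spec-weaken = λ { {p = p} P⇒Q s≤t (Pp , ≤s) → P⇒Q (value p) Pp , ≤-trans ≤s s≤t }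
  }

randomizedLogic : CostLogic randomized
randomizedLogic = record
  { Spec        = RandSpec
  ; spec-return = λ {A} {P} {a} Pa → (λ { _ (halt refl) → Pa }) , λ { zero → ℚ.≤-refl ; (suc t) → ℚ.≤-refl }
  ; spec-tick   = (λ _ _ → tt) , tick-time
  ; spec-bind   = λ {A} {B} {p} {f} {P} {Q} {s} {t} → bind {A} {B} {p} {f} {P} {Q} {s} {t}
  ; spec-weaken = λ P⇒Q s≤t (Pp , ≤s) → (λ a o → P⇒Q a (Pp a o)) , λ t → ℚ.≤-trans (≤s t) (fromℕ-mono-≤ s≤t)
  }
  where
  RandSpec : {A : Set} → Rand A → (A → Set) → ℕ → Set
  RandSpec p P t = (∀ a → MayOutput p a → P a) × ExpectedTime≤ p (fromℕ t)
  tick-time : ExpectedTime≤ (CostMonad.tick randomized) (fromℕ 1)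
  tick-time zero          = fromℕ-mono-≤ {0} {1} z≤n
  tick-time (suc zero)    = ℚ.≤-refl
  tick-time (suc (suc t)) = ℚ.≤-refl
  bind : ∀ {A B} {p : Rand A} {f : A → Rand B} {P : A → Set} {Q : B → Set} {s t} →
    RandSpec p P s → (∀ a → P a → RandSpec (f a) Q t) → RandSpec (bindRand p f) Q (s + t)
  bind {p = p} {f} {s = s} {t} (Pp , p≤s) q =
    (λ b o → let a , oa , ob = outputs-bind p f o in proj₁ (q a (Pp a oa)) b ob) ,
    (λ r → begin
      truncatedExpectation (bindRand p f) r (inj₁ (Rand.start p))
        ≤⟨ truncated-bind p f (fromℕ-mono-≤ {0} {t} z≤n) r (Rand.start p) (λ a oa → proj₂ (q a (Pp a oa))) ⟩
      truncatedExpectation p r (Rand.start p) ℚ.+ fromℕ t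
        ≤⟨ ℚ.+-monoˡ-≤ (fromℕ t) (p≤s r) ⟩
      fromℕ s ℚ.+ fromℕ t
        ≡⟨ fromℕ-+ s t ⟨
      fromℕ (s + t) ∎)
    where open ℚ.≤-Reasoning

-- Oriented splitting and the recursion

degree≤maxDegree : (G : Graph n) → ∀ v → degree G v ≤ maxDegree G
degree≤maxDegree {n} G = All.tabulate⁻ (All.map⁻ {f = degree G} (xs≤max 0 (map (degree G) (allFin n))))

maxDegree≤ : (G : Graph n) → ∀ {d} → (∀ v → degree G v ≤ d) → maxDegree G ≤ d
maxDegree≤ G deg≤d = max≤v⁺ z≤n (All.map⁺ (All.tabulate⁺ deg≤d))

larger-half : ∀ {s} a b → s ≡ a + b → ∣ a - b ∣ ≤ 1 → 2 * a ≤ s + 1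
larger-half a b refl close = begin
  2 * a                ≡⟨ cong (a +_) (+-identityʳ a) ⟩
  a + a                ≤⟨ +-monoʳ-≤ a (m≤n+∣m-n∣ a b) ⟩
  a + (b + ∣ a - b ∣)  ≤⟨ +-monoʳ-≤ a (+-monoʳ-≤ b close) ⟩
  a + (b + 1)          ≡⟨ +-assoc a b 1 ⟨
  a + b + 1            ∎
  where open ≤-Reasoning

module Splitting {n} {H H₁ H₂ : Graph n} {μ : Orientation n} (split : IsOrientedSplitting H μ 1 H₁ H₂) where
  open IsOrientedSplitting split

  edge₁ : ∀ {u v} → Edge H₁ u v → Edge H u v
  edge₁ {u} {v} e = subst T (sym (trans (covers u v) (cong (_∨ adj H₂ u v) (T⇒≡true e)))) tt

  edge₂ : ∀ {u v} → Edge H₂ u v → Edge H u v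
  edge₂ {u} {v} e = subst T (sym (trans (covers u v) (trans (cong (adj H₁ u v ∨_) (T⇒≡true e)) (∨-zeroʳ (adj H₁ u v))))) tt

  edge⇒edge₂ : ∀ {u v} → adj H₁ u v ≡ false → Edge H u v → Edge H₂ u v
  edge⇒edge₂ {u} {v} ≡false = subst T (trans (covers u v) (cong (_∨ adj H₂ u v) ≡false))

  -- The free Boolean `b` lets one count serve in-degrees, out-degrees and, as `u <ᵇ v`, the edge
  -- list.
  count-split : ∀ b u v → 𝟙 (adj H u v ∧ b) ≡ 𝟙 (adj H₁ u v ∧ b) + 𝟙 (adj H₂ u v ∧ b)
  count-split b u v rewrite covers u v = 𝟙-disjoint (adj H₁ u v) (adj H₂ u v) b (disjoint u v)

  inDegree-split : ∀ v → inDegree H μ v ≡ inDegree H₁ μ v + inDegree H₂ μ v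
  inDegree-split v rewrite inDegree-∑ H μ v | inDegree-∑ H₁ μ v | inDegree-∑ H₂ μ v =
    trans (sum-cong-≗ (λ u → count-split (μ u v) u v))
          (∑-distrib-+ (λ u → 𝟙 (adj H₁ u v ∧ μ u v)) (λ u → 𝟙 (adj H₂ u v ∧ μ u v)))

  outDegree-split : ∀ v → outDegree H μ v ≡ outDegree H₁ μ v + outDegree H₂ μ v
  outDegree-split v rewrite outDegree-∑ H μ v | outDegree-∑ H₁ μ v | outDegree-∑ H₂ μ v =
    trans (sum-cong-≗ (λ u → count-split (μ v u) v u))
          (∑-distrib-+ (λ u → 𝟙 (adj H₁ v u ∧ μ v u)) (λ u → 𝟙 (adj H₂ v u ∧ μ v u)))

  numEdges-split : numEdges H ≡ numEdges H₁ + numEdges H₂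
  numEdges-split rewrite numEdges-∑ H | numEdges-∑ H₁ | numEdges-∑ H₂ =
    trans (sum-cong-≗ (λ u → trans (sum-cong-≗ (pointwise u)) (∑-distrib-+ (e H₁ u) (e H₂ u))))
          (∑-distrib-+ (λ u → sum (e H₁ u)) (λ u → sum (e H₂ u)))
    where
    e : Graph n → Fin n → Fin n → ℕ
    e H u v = 𝟙 (u <ᵇ v ∧ adj H u v)
    pointwise : ∀ u v → e H u v ≡ e H₁ u v + e H₂ u v
    pointwise u v rewrite ∧-comm (u <ᵇ v) (adj H u v) | ∧-comm (u <ᵇ v) (adj H₁ u v)
                        | ∧-comm (u <ᵇ v) (adj H₂ u v) = count-split (u <ᵇ v) u v

  inDegree₁ : ∀ v → 2 * inDegree H₁ μ v ≤ inDegree H μ v + 1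
  inDegree₁ v = larger-half _ (inDegree H₂ μ v) (inDegree-split v) (inDiscrepancy v)

  inDegree₂ : ∀ v → 2 * inDegree H₂ μ v ≤ inDegree H μ v + 1
  inDegree₂ v = larger-half _ (inDegree H₁ μ v) (trans (inDegree-split v) (+-comm _ (inDegree H₂ μ v)))
    (subst (_≤ 1) (∣-∣-comm (inDegree H₁ μ v) _) (inDiscrepancy v))

  outDegree₁ : ∀ v → 2 * outDegree H₁ μ v ≤ outDegree H μ v + 1
  outDegree₁ v = larger-half _ (outDegree H₂ μ v) (outDegree-split v) (outDiscrepancy v)

  outDegree₂ : ∀ v → 2 * outDegree H₂ μ v ≤ outDegree H μ v + 1
  outDegree₂ v = larger-half _ (outDegree H₁ μ v) (trans (outDegree-split v) (+-comm _ (outDegree H₂ μ v)))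
    (subst (_≤ 1) (∣-∣-comm (outDegree H₁ μ v) _) (outDiscrepancy v))

  open IsProperEdgeColoring

  merge-proper : ∀ {φ₁ φ₂} → IsProperEdgeColoring H₁ (palette φ₁) (color φ₁) →
    IsProperEdgeColoring H₂ (palette φ₂) (color φ₂) →
    IsProperEdgeColoring H (palette (merge H₁ φ₁ φ₂)) (color (merge H₁ φ₁ φ₂))
  merge-proper {φ₁} {φ₂} C₁ C₂ = record { undirected = und ; inPalette = pal ; proper = prop }
    where
    φ = color (merge H₁ φ₁ φ₂)

    und : ∀ u v → Edge H u v → φ u v ≡ φ v u
    und u v e rewrite symmetric H₁ v u with adj H₁ u v in eq
    ... | true  = undirected C₁ u v (subst T (sym eq) tt)
    ... | false = cong (palette φ₁ +_) (undirected C₂ u v (edge⇒edge₂ eq e))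

    pal : ∀ u v → Edge H u v → 1 ≤ φ u v × φ u v ≤ palette φ₁ + palette φ₂
    pal u v e with adj H₁ u v in eq
    ... | true  = let ≥1 , ≤k = inPalette C₁ u v (subst T (sym eq) tt) in
                  ≥1 , ≤-trans ≤k (m≤m+n _ _)
    ... | false = let ≥1 , ≤k = inPalette C₂ u v (edge⇒edge₂ eq e) in
                  ≤-trans ≥1 (m≤n+m _ (palette φ₁)) , +-monoʳ-≤ (palette φ₁) ≤k

    -- Colors start at 1, so a shifted color lies strictly above the first palette.
    separate : ∀ {u v w} → Edge H₁ u v → Edge H₂ u w → color φ₁ u v ≢ palette φ₁ + color φ₂ u w
    separate {u} {v} {w} e₁ e₂ = <⇒≢ (≤-<-trans (proj₂ (inPalette C₁ u v e₁))
      (≤-trans (≤-reflexive (+-comm 1 (palette φ₁))) (+-monoʳ-≤ (palette φ₁) (proj₁ (inPalette C₂ u w e₂)))))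

    prop : ∀ u v w → Edge H u v → Edge H u w → v ≢ w → φ u v ≢ φ u w
    prop u v w ev ew v≢w with adj H₁ u v in eqv | adj H₁ u w in eqw
    ... | true  | true  = proper C₁ u v w (subst T (sym eqv) tt) (subst T (sym eqw) tt) v≢w
    ... | true  | false = separate (subst T (sym eqv) tt) (edge⇒edge₂ eqw ew)
    ... | false | true  = separate (subst T (sym eqw) tt) (edge⇒edge₂ eqv ev) ∘ sym
    ... | false | false = proper C₂ u v w (edge⇒edge₂ eqv ev) (edge⇒edge₂ eqw ew) v≢w ∘ +-cancelˡ-≡ (palette φ₁) _ _

weaken-palette : ∀ {G : Graph n} {j k φ} → j ≤ k → IsProperEdgeColoring G j φ → IsProperEdgeColoring G k φ
weaken-palette j≤k C = record
  { undirected = undirected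
  ; inPalette  = λ u v e → let ≥1 , ≤j = inPalette u v e in ≥1 , ≤-trans ≤j j≤k
  ; proper     = proper
  }
  where open IsProperEdgeColoring C

-- Rounding and absorption estimates

half-≤ : ∀ {x d} → 2 * x ≤ d + 2 → x ≤ suc ⌊ d /2⌋
half-≤ {x} {d} 2x≤ = begin
  x                    ≡⟨ n≡⌊n+n/2⌋ x ⟩
  ⌊ x + x /2⌋          ≤⟨ ⌊n/2⌋-mono (subst₂ _≤_ (cong (x +_) (+-identityʳ x)) (+-comm d 2) 2x≤) ⟩
  suc ⌊ d /2⌋          ∎
  where open ≤-Reasoning

2*⌊/2⌋≤ : ∀ d → 2 * ⌊ d /2⌋ ≤ d
2*⌊/2⌋≤ zero          = z≤n
2*⌊/2⌋≤ (suc zero)    = z≤n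
2*⌊/2⌋≤ (suc (suc d)) = ≤-trans (≤-reflexive (*-suc 2 ⌊ d /2⌋)) (s≤s (s≤s (2*⌊/2⌋≤ d)))

^-distrib-* : ∀ a b e → (a * b) ^ e ≡ a ^ e * b ^ e
^-distrib-* a b zero    = refl
^-distrib-* a b (suc e) = trans (cong (a * b *_) (^-distrib-* a b e)) (arith a b (a ^ e) (b ^ e))
  where
  arith : ∀ a b x y → a * b * (x * y) ≡ (a * x) * (b * y)
  arith = solve-∀

-- With at most one vertex the edge list computes to the empty list, so those cases are absurd. This
-- is what lets costs without a logarithm be absorbed.
log₂≥1 : (G : Graph n) → 1 ≤ numEdges G → 1 ≤ ⌈log₂ n ⌉
log₂≥1 {suc (suc n)} G _ = ⌈log₂⌉-mono-≤ {2} {2 + n} (s≤s (s≤s z≤n))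

-- Out-degrees are trivially at most n, so any orientation gives arboricity at most 2n; this crude
-- bound suffices, the extra 1 in log (2n) being absorbed by `log₂≥1`.
height≤2*log₂ : (G : Graph n) {μ : Orientation n} → IsOrientation G μ → 1 ≤ numEdges G →
  ∀ h → 2 ^ h ≤ arboricity G → h ≤ 2 * ⌈log₂ n ⌉
height≤2*log₂ {suc n} G {μ} oriented 1≤m h 2^h≤α = begin
  h                              ≡⟨ ⌈log₂2^n⌉≡n h ⟨
  ⌈log₂ 2 ^ h ⌉                  ≤⟨ ⌈log₂⌉-mono-≤ (≤-trans 2^h≤α (arboricity≤2*outDegree G μ oriented outDegree≤n)) ⟩
  ⌈log₂ (2 * suc n) ⌉            ≡⟨ ⌈log₂2*n⌉≡1+⌈log₂n⌉ (suc n) ⟩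
  1 + ⌈log₂ suc n ⌉              ≤⟨ +-monoˡ-≤ ⌈log₂ suc n ⌉ (log₂≥1 G 1≤m) ⟩
  ⌈log₂ suc n ⌉ + ⌈log₂ suc n ⌉  ≡⟨ cong (⌈log₂ suc n ⌉ +_) (+-identityʳ _) ⟨
  2 * ⌈log₂ suc n ⌉              ∎
  where
  open ≤-Reasoning
  outDegree≤n : ∀ v → outDegree G μ v ≤ suc n
  outDegree≤n v rewrite outDegree-∑ G μ v =
    ≤-trans (sum≤n*c 1 (λ u → 𝟙≤1 (adj G v u ∧ μ v u))) (≤-reflexive (*-identityʳ (suc n)))

-- The remainder is below `p`, so `(a / p + 1) * p` covers `a`. With `p = 2 ^ h` this puts the
-- initial out-degree bound, twice the arboricity, into the form `B * 2 ^ h + 1` of `Invariant`.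
2*≤quotient : ∀ a p .{{_ : NonZero p}} → 2 * a ≤ 2 * (a / p + 1) * p + 1
2*≤quotient a p = begin
  2 * a                                   ≡⟨ cong (2 *_) (m≡m%n+[m/n]*n a p) ⟩
  2 * (a % p + a / p * p)                     ≤⟨ *-monoʳ-≤ 2 (+-monoˡ-≤ (a / p * p) (<⇒≤ (m%n<n a p))) ⟩
  2 * (p + a / p * p)                     ≤⟨ m≤m+n _ 1 ⟩
  2 * (p + a / p * p) + 1                 ≡⟨ arith (a / p) p ⟩
  2 * (a / p + 1) * p + 1                 ∎
  where
  open ≤-Reasoning
  arith : ∀ q p → 2 * (p + q * p) + 1 ≡ 2 * (q + 1) * p + 1
  arith = solve-∀

-- With q = `a / p`, the factor before `p` is 4q + 6, the arboricity bound `2 * (B + 1)` at a leaf;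
-- the constant is 4 from qp ≤ a plus 6 from p ≤ a.
quotient≤10* : ∀ {a p} .{{_ : NonZero p}} → p ≤ a → 2 * (2 * (a / p + 1) + 1) * p ≤ 10 * a
quotient≤10* {a} {p} p≤a = begin
  2 * (2 * (a / p + 1) + 1) * p           ≡⟨ arith₁ (a / p) p ⟩
  4 * (a / p * p) + 6 * p                 ≤⟨ +-mono-≤ (*-monoʳ-≤ 4 (m/n*n≤m a p)) (*-monoʳ-≤ 6 p≤a) ⟩
  4 * a + 6 * a                           ≡⟨ arith₂ a ⟩
  10 * a                                  ∎
  where
  open ≤-Reasoning
  arith₁ : ∀ q p → 2 * (2 * (q + 1) + 1) * p ≡ 4 * (q * p) + 6 * p
  arith₁ = solve-∀
  arith₂ : ∀ a → 4 * a + 6 * a ≡ 10 * a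
  arith₂ = solve-∀

-- Palette and cost of the recursion

module Recursion {ℓ} {𝓜 : CostMonad ℓ} (logic : CostLogic 𝓜)
  (split : Splitter) (splitter : IsLinearTimeSplitter split)
  (base : BaseCase 𝓜) (e c : ℕ)
  (base-spec : ∀ {n} (H : Graph n) → CostLogic.Spec logic (base H) (IsBaseColoring H)
                 (c * (1 + numEdges H * arboricity H ^ e * ⌈log₂ n ⌉)))
  where

  open CostMonad 𝓜
  open CostLogic logic
  open IsLinearTimeSplitter splitter

  -- One constant covers an internal call twice over: its fixed cost, one tick plus the splitter's
  -- constant, and its cost per edge, the splitter's plus one for merging.
  K : ℕ
  K = 1 + proj₁ linear

  -- The summands are `K` per edge on each splitting level; for each leaf its constant `1 + c` and
  -- one credit `K`; and the base colorings, with `2 * (B + 1)` in place of the leaf arboricities.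
  -- The graph enters only through its edge count, linearly, so the costs of the two halves add up.
  levelCost : ∀ {n} → ℕ → Graph n → (B : ℕ) → ℕ
  levelCost {n} h H B =
    h * K * numEdges H + 2 ^ h * (1 + c + K) + c * (numEdges H * (2 * (B + 1)) ^ e * ⌈log₂ n ⌉)

  -- The bound `B * 2 ^ h + 1` halves without loss: adding 1 to `B * 2 ^ suc h + 1` and halving
  -- gives exactly this.
  record Invariant {n} (H : Graph n) (μ : Orientation n) (D B h : ℕ) : Set where
    field
      oriented : IsOrientation H μ
      degree≤  : ∀ v → inDegree H μ v + outDegree H μ v ≤ D
      out≤     : ∀ v → outDegree H μ v ≤ B * 2 ^ h + 1

  -- The h in Invariant counts the splittings still to come, so that B is fixed
  -- throughout and a leaf has out-degrees at most B + 1.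
  invariant-half : ∀ {n} {H H′ : Graph n} {μ D B h} →
    (∀ {u v} → Edge H′ u v → Edge H u v) →
    (∀ v → 2 * inDegree H′ μ v ≤ inDegree H μ v + 1) →
    (∀ v → 2 * outDegree H′ μ v ≤ outDegree H μ v + 1) →
    Invariant H μ D B (suc h) → Invariant H′ μ (suc ⌊ D /2⌋) B h
  invariant-half {H = H} {H′} {μ} {D} {B} {h} sub in½ out½ I = record
    { oriented = λ u v e → oriented u v (sub e)
    ; degree≤  = λ v → half-≤ (deg v)
    ; out≤     = λ v → *-cancelˡ-≤ 2 (out v)
    }
    where
    open Invariant I
    open ≤-Reasoning
    shuffle : ∀ a b → (a + 1) + (b + 1) ≡ (a + b) + 2
    shuffle = solve-∀
    deg : ∀ v → 2 * (inDegree H′ μ v + outDegree H′ μ v) ≤ D + 2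
    deg v = begin
      2 * (inDegree H′ μ v + outDegree H′ μ v)          ≡⟨ *-distribˡ-+ 2 (inDegree H′ μ v) (outDegree H′ μ v) ⟩
      2 * inDegree H′ μ v + 2 * outDegree H′ μ v        ≤⟨ +-mono-≤ (in½ v) (out½ v) ⟩
      (inDegree H μ v + 1) + (outDegree H μ v + 1)      ≡⟨ shuffle (inDegree H μ v) (outDegree H μ v) ⟩
      (inDegree H μ v + outDegree H μ v) + 2            ≤⟨ +-monoˡ-≤ 2 (degree≤ v) ⟩
      D + 2                                             ∎
    double : ∀ b p → b * (2 * p) + 1 + 1 ≡ 2 * (b * p + 1)
    double = solve-∀
    out : ∀ v → 2 * outDegree H′ μ v ≤ 2 * (B * 2 ^ h + 1)
    out v = begin
      2 * outDegree H′ μ v          ≤⟨ out½ v ⟩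
      outDegree H μ v + 1           ≤⟨ +-monoˡ-≤ 1 (out≤ v) ⟩
      B * 2 ^ suc h + 1 + 1         ≡⟨ double B (2 ^ h) ⟩
      2 * (B * 2 ^ h + 1)           ∎

  -- The slack of 2 closes the induction: the degree bounds of two halves add up to as much as
  -- `D + 2`, and of their two slacks one pays for this surplus while the other is handed on. A leaf
  -- has at most `D + 1` colors, hence the coefficient 3.
  ProperWithin : ∀ {n} → Graph n → ℕ → Coloring n → Set
  ProperWithin H b φ = IsProperEdgeColoring H (palette φ) (color φ) × palette φ + 2 ≤ b

  -- The summand K on the left pays for the parent call: the internal nodes of
  -- the recursion tree are one fewer than its 2^h leaves.
  orientedEdgeColoring-spec : ∀ {n} h (H : Graph n) {μ D B} → Invariant H μ D B h →
    ∃ λ t → Spec (orientedEdgeColoring 𝓜 split base H μ h) (ProperWithin H (D + 3 * 2 ^ h)) t ×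
            t + K ≤ levelCost h H B
  orientedEdgeColoring-spec {n} zero H {μ} {D} {B} I =
    1 + baseTime , spec-bind spec-tick (λ _ _ → spec-weaken post ≤-refl (base-spec H)) , time≤
    where
    open Invariant I
    open ≤-Reasoning
    m = numEdges H
    L = ⌈log₂ n ⌉
    A = 2 * (B + 1)
    baseTime = c * (1 + m * arboricity H ^ e * L)

    maxDegree≤D : maxDegree H ≤ D
    maxDegree≤D = maxDegree≤ H (λ v → ≤-trans (≤-reflexive (degree-in-out H μ oriented v)) (degree≤ v))

    post : ∀ φ → IsBaseColoring H φ → ProperWithin H (D + 3) φ
    post φ (size , proper) = proper , (begin
      palette φ + 2        ≡⟨ cong (_+ 2) size ⟩
      maxDegree H + 1 + 2  ≡⟨ +-assoc (maxDegree H) 1 2 ⟩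
      maxDegree H + 3      ≤⟨ +-monoˡ-≤ 3 maxDegree≤D ⟩
      D + 3                ∎)

    arboricity≤A : arboricity H ≤ A
    arboricity≤A = arboricity≤2*outDegree H μ oriented
      (λ v → subst (λ b → outDegree H μ v ≤ b + 1) (*-identityʳ B) (out≤ v))

    arith : ∀ k c w → 1 + c * (1 + w) + k ≡ 1 * (1 + c + k) + c * w
    arith = solve-∀

    time≤ : 1 + baseTime + K ≤ levelCost 0 H B
    time≤ = begin
      1 + c * (1 + m * arboricity H ^ e * L) + K
        ≤⟨ +-monoˡ-≤ K (+-monoʳ-≤ 1 (*-monoʳ-≤ c (+-monoʳ-≤ 1 (*-monoˡ-≤ L (*-monoʳ-≤ m (^-monoˡ-≤ e arboricity≤A)))))) ⟩
      1 + c * (1 + m * A ^ e * L) + K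
        ≡⟨ arith K c (m * A ^ e * L) ⟩
      1 * (1 + c + K) + c * (m * A ^ e * L) ∎
  orientedEdgeColoring-spec {n} (suc h) H {μ} {D} {B} I
    with t₁ , spec₁ , t₁≤ ← orientedEdgeColoring-spec h (proj₁ (value (split H μ)))
           (let open Splitting (splits H μ (Invariant.oriented I)) in
            invariant-half edge₁ inDegree₁ outDegree₁ I)
    with t₂ , spec₂ , t₂≤ ← orientedEdgeColoring-spec h (proj₂ (value (split H μ)))
           (let open Splitting (splits H μ (Invariant.oriented I)) in
            invariant-half edge₂ inDegree₂ outDegree₂ I)
    =
    (1 + ts) + (t₁ + (t₂ + (m + 0))) ,
    -- The splitter is deterministic in both versions, so equality serves as postcondition and fixes
    -- the two halves before the calls on them are analysed.
    spec-bind {P = _≡ value (split H μ)} (spec-bind spec-tick (λ _ _ → spec-liftTimed (split H μ) refl))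
      (λ { _ refl → spec-bind spec₁ (λ φ₁ C₁ → spec-bind spec₂ (λ φ₂ C₂ →
             spec-bind (spec-ticks m) (λ _ _ → spec-return (post C₁ C₂)))) }) ,
    time≤
    where
    open Invariant I
    open Splitting (splits H μ oriented)
    open ≤-Reasoning
    H₁ = proj₁ (value (split H μ))
    H₂ = proj₂ (value (split H μ))
    m  = numEdges H
    m₁ = numEdges H₁
    m₂ = numEdges H₂
    ts = time (split H μ)
    w  = (2 * (B + 1)) ^ e
    L  = ⌈log₂ n ⌉
    D½ = suc ⌊ D /2⌋

    post : ∀ {φ₁ φ₂} → ProperWithin H₁ (D½ + 3 * 2 ^ h) φ₁ → ProperWithin H₂ (D½ + 3 * 2 ^ h) φ₂ →
      ProperWithin H (D + 3 * 2 ^ suc h) (merge H₁ φ₁ φ₂)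
    post {φ₁} {φ₂} (C₁ , p₁≤) (C₂ , p₂≤) = merge-proper C₁ C₂ , +-cancelʳ-≤ 2 _ _ (begin
      palette φ₁ + palette φ₂ + 2 + 2            ≡⟨ arith₁ (palette φ₁) (palette φ₂) ⟩
      (palette φ₁ + 2) + (palette φ₂ + 2)        ≤⟨ +-mono-≤ p₁≤ p₂≤ ⟩
      (D½ + 3 * 2 ^ h) + (D½ + 3 * 2 ^ h)        ≡⟨ arith₂ ⌊ D /2⌋ (2 ^ h) ⟩
      2 * ⌊ D /2⌋ + (3 * 2 ^ suc h + 2)          ≤⟨ +-monoˡ-≤ (3 * 2 ^ suc h + 2) (2*⌊/2⌋≤ D) ⟩
      D + (3 * 2 ^ suc h + 2)                    ≡⟨ +-assoc D (3 * 2 ^ suc h) 2 ⟨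
      D + 3 * 2 ^ suc h + 2                      ∎)
      where
      arith₁ : ∀ a b → a + b + 2 + 2 ≡ (a + 2) + (b + 2)
      arith₁ = solve-∀
      arith₂ : ∀ d p → (suc d + 3 * p) + (suc d + 3 * p) ≡ 2 * d + (3 * (2 * p) + 2)
      arith₂ = solve-∀

    arith₃ : ∀ s m t₁ t₂ → (1 + s * (1 + m)) + (t₁ + (t₂ + (m + 0))) + (1 + s) ≡
             (t₁ + (1 + s)) + (t₂ + (1 + s)) + (1 + s) * m
    arith₃ = solve-∀
    arith₄ : ∀ h k m₁ m₂ p x c w l →
      (h * k * m₁ + p * x + c * (m₁ * w * l)) + (h * k * m₂ + p * x + c * (m₂ * w * l)) + k * (m₁ + m₂) ≡
      (1 + h) * k * (m₁ + m₂) + (2 * p) * x + c * ((m₁ + m₂) * w * l)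
    arith₄ = solve-∀

    time≤ : (1 + ts) + (t₁ + (t₂ + (m + 0))) + K ≤ levelCost (suc h) H B
    time≤ = begin
      (1 + ts) + (t₁ + (t₂ + (m + 0))) + K
        ≤⟨ +-monoˡ-≤ K (+-monoˡ-≤ (t₁ + (t₂ + (m + 0))) (+-monoʳ-≤ 1 (proj₂ linear H μ oriented))) ⟩
      (1 + proj₁ linear * (1 + m)) + (t₁ + (t₂ + (m + 0))) + K
        ≡⟨ arith₃ (proj₁ linear) m t₁ t₂ ⟩
      (t₁ + K) + (t₂ + K) + K * m
        ≤⟨ +-monoˡ-≤ (K * m) (+-mono-≤ t₁≤ t₂≤) ⟩
      levelCost h H₁ B + levelCost h H₂ B + K * m
        ≡⟨ cong (λ m → levelCost h H₁ B + levelCost h H₂ B + K * m) numEdges-split ⟩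
      levelCost h H₁ B + levelCost h H₂ B + K * (m₁ + m₂)
        ≡⟨ arith₄ h K m₁ m₂ (2 ^ h) (1 + c + K) c w L ⟩
      suc h * K * (m₁ + m₂) + 2 ^ suc h * (1 + c + K) + c * ((m₁ + m₂) * w * L)
        ≡⟨ cong (λ m → suc h * K * m + 2 ^ suc h * (1 + c + K) + c * (m * w * L)) numEdges-split ⟨
      levelCost (suc h) H B ∎

  -- One summand per cost: 8 for the orientation, `2 * K` for the levels via `h ≤ 2 * L`,
  -- `1 + c + K` for the constants of the leaves, `c * 10 ^ e` for the base colorings.
  C : ℕ
  C = 8 + 2 * K + (1 + c + K) + c * 10 ^ e

  -- With `p = 2 ^ h`, the factor `p ^ e` is the denominator of the claimed bound moved to the left.
  -- The base cost cancels it through `A * p ≤ 10 * a`; the other costs can afford to lose it to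
  -- `a ^ e`.
  totalCost≤ : ∀ {m a p h L A} → 1 ≤ L → h ≤ 2 * L → p ≤ a → p ≤ m → A * p ≤ 10 * a →
    (8 * m + (h * K * m + p * (1 + c + K) + c * (m * A ^ e * L))) * p ^ e ≤ C * (m * a ^ e * L)
  totalCost≤ {m} {a} {p} {h} {L} {A} 1≤L h≤2L p≤a p≤m Ap≤10a = begin
    (8 * m + (h * K * m + p * X + c * (m * A ^ e * L))) * q
      ≡⟨ arith₁ m h K p X c (A ^ e) L q ⟩
    8 * (m * q * 1) + K * (m * q * h) + X * (p * q * 1) + c * (m * (A ^ e * q) * L)
      ≤⟨ +-mono-≤ (+-mono-≤ (+-mono-≤
           (*-monoʳ-≤ 8 (*-mono-≤ (*-monoʳ-≤ m q≤) 1≤L))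
           (*-monoʳ-≤ K (*-mono-≤ (*-monoʳ-≤ m q≤) h≤2L)))
           (*-monoʳ-≤ X (*-mono-≤ (*-mono-≤ p≤m q≤) 1≤L)))
           (*-monoʳ-≤ c (*-monoˡ-≤ L (*-monoʳ-≤ m Aq≤))) ⟩
    8 * (m * a ^ e * L) + K * (m * a ^ e * (2 * L)) + X * (m * a ^ e * L) + c * (m * (10 ^ e * a ^ e) * L)
      ≡⟨ arith₂ m (a ^ e) L K X c (10 ^ e) ⟩
    C * (m * a ^ e * L) ∎
    where
    open ≤-Reasoning
    X = 1 + c + K
    q = p ^ e
    q≤ : q ≤ a ^ e
    q≤ = ^-monoˡ-≤ e p≤a
    Aq≤ : A ^ e * q ≤ 10 ^ e * a ^ e
    Aq≤ = begin
      A ^ e * p ^ e    ≡⟨ ^-distrib-* A p e ⟨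
      (A * p) ^ e      ≤⟨ ^-monoˡ-≤ e Ap≤10a ⟩
      (10 * a) ^ e     ≡⟨ ^-distrib-* 10 a e ⟩
      10 ^ e * a ^ e   ∎
    arith₁ : ∀ m h k p x c w l q → (8 * m + (h * k * m + p * x + c * (m * w * l))) * q ≡
      8 * (m * q * 1) + k * (m * q * h) + x * (p * q * 1) + c * (m * (w * q) * l)
    arith₁ = solve-∀
    arith₂ : ∀ m y l k x c z →
      8 * (m * y * l) + k * (m * y * (2 * l)) + x * (m * y * l) + c * (m * (z * y) * l) ≡
      (8 + 2 * k + x + c * z) * (m * y * l)
    arith₂ = solve-∀

  arboricityEdgeColoring-spec : ∀ {n} (G : Graph n) h → 2 ^ h ≤ arboricity G →
    ∃ λ t → Spec (arboricityEdgeColoring 𝓜 split base G h)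
                 (λ φ → IsProperEdgeColoring G (maxDegree G + 3 * 2 ^ h) (color φ)) t ×
            t * 2 ^ (e * h) ≤ C * (numEdges G * arboricity G ^ e * ⌈log₂ n ⌉)
  arboricityEdgeColoring-spec {n} G h 2^h≤α =
    let t , spec , t≤ = orientedEdgeColoring-spec h G invariant in
      t₀ + t ,
      spec-bind {P = _≡ μ} (spec-liftTimed (forestsDecompositionOrientation G) refl)
        (λ { _ refl → spec-weaken post ≤-refl spec }) ,
      (begin
        (t₀ + t) * 2 ^ (e * h)
          ≤⟨ *-monoˡ-≤ (2 ^ (e * h)) (+-mono-≤ (forestsDecomposition-time G 1≤α) (≤-trans (m≤m+n t K) t≤)) ⟩
        (8 * m + levelCost h G B) * 2 ^ (e * h)
          ≡⟨ cong ((8 * m + levelCost h G B) *_) (trans (cong (2 ^_) (*-comm e h)) (sym (^-*-assoc 2 h e))) ⟩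
        (8 * m + levelCost h G B) * (2 ^ h) ^ e
          ≤⟨ totalCost≤ {m} {α} {2 ^ h} {h} {⌈log₂ n ⌉} {2 * (B + 1)} (log₂≥1 G 1≤m)
               (height≤2*log₂ G oriented 1≤m h 2^h≤α) 2^h≤α (≤-trans 2^h≤α (arboricity≤numEdges G))
               (quotient≤10* 2^h≤α) ⟩
        C * (m * α ^ e * ⌈log₂ n ⌉) ∎)
    where
    open ≤-Reasoning
    instance
      2^h≢0 : NonZero (2 ^ h)
      2^h≢0 = m^n≢0 2 h
    α  = arboricity G
    m  = numEdges G
    μ  = value (forestsDecompositionOrientation G)
    t₀ = time (forestsDecompositionOrientation G)
    B  = 2 * (α / 2 ^ h + 1)

    1≤α : 1 ≤ α
    1≤α = ≤-trans (m^n>0 2 h) 2^h≤α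

    1≤m : 1 ≤ m
    1≤m = ≤-trans 1≤α (arboricity≤numEdges G)

    oriented : IsOrientation G μ
    oriented = forestsDecomposition-orients G 1≤α

    invariant : Invariant G μ (maxDegree G) B h
    invariant = record
      { oriented = oriented
      ; degree≤  = λ v → ≤-trans (≤-reflexive (sym (degree-in-out G μ oriented v))) (degree≤maxDegree G v)
      ; out≤     = λ v → ≤-trans (forestsDecomposition-outDegree G 1≤α v) (2*≤quotient α (2 ^ h))
      }

    post : ∀ φ → ProperWithin G (maxDegree G + 3 * 2 ^ h) φ →
           IsProperEdgeColoring G (maxDegree G + 3 * 2 ^ h) (color φ)
    post φ (proper , size) = weaken-palette (≤-trans (m≤m+n (palette φ) 2) size) proper

fromℕ≤/2^ : ∀ {a b} j → a * 2 ^ j ≤ b → fromℕ a ℚ.≤ b /2^ j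
fromℕ≤/2^ {a} j = fromℕ≤/ {a} (2 ^ j) {{m^n≢0 2 j}}

theorem4p15 : (split : Splitter) → IsLinearTimeSplitter split →
    ((base : BaseCase deterministic) → IsDeterministicBaseCase base →
    ∃ λ (C : ℕ) → ∀ (n : ℕ) (G : Graph n) (h : ℕ) → 2 ^ h ≤ arboricity G →
    let run = arboricityEdgeColoring deterministic split base G h in
    IsProperEdgeColoring G (maxDegree G + 3 * 2 ^ h) (color (value run)) ×
    fromℕ (time run) ℚ.≤ (C * (numEdges G * arboricity G ^ 7 * ⌈log₂ n ⌉)) /2^ (7 * h))
    ×
    ((base : BaseCase randomized) → IsRandomizedBaseCase base →
    ∃ λ (C : ℕ) → ∀ (n : ℕ) (G : Graph n) (h : ℕ) → 2 ^ h ≤ arboricity G →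
    let run = arboricityEdgeColoring randomized split base G h in
    (∀ φ → MayOutput run φ → IsProperEdgeColoring G (maxDegree G + 3 * 2 ^ h) (color φ)) ×
    ExpectedTime≤ run ((C * (numEdges G * arboricity G * ⌈log₂ n ⌉)) /2^ h))
theorem4p15 split splitter = deterministicPart , randomizedPart
  where
  deterministicPart : (base : BaseCase deterministic) → IsDeterministicBaseCase base → _
  deterministicPart base isBase = D.C , λ n G h 2^h≤α →
    let t , (proper , time≤t) , t≤ = D.arboricityEdgeColoring-spec G h 2^h≤α in
    proper , ℚ.≤-trans (fromℕ-mono-≤ time≤t) (fromℕ≤/2^ {t} (7 * h) t≤)
    where
    open IsDeterministicBaseCase isBase
    module D = Recursion deterministicLogic split splitter base 7 (proj₁ fast)
      (λ H → colors H , proj₂ fast H)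

  randomizedPart : (base : BaseCase randomized) → IsRandomizedBaseCase base → _
  randomizedPart base isBase = R.C , λ n G h 2^h≤α →
    let t , (proper , time≤t) , t≤ = R.arboricityEdgeColoring-spec G h 2^h≤α
        t≤′ = subst₂ (λ a j → t * 2 ^ j ≤ R.C * (numEdges G * a * ⌈log₂ n ⌉))
                     (^-identityʳ (arboricity G)) (*-identityˡ h) t≤
    in proper , λ r → ℚ.≤-trans (time≤t r) (fromℕ≤/2^ {t} h t≤′)
    where
    open IsRandomizedBaseCase isBase
    module R = Recursion randomizedLogic split splitter base 1 (proj₁ fast)
      (λ {n} H → colors H , subst (λ a → ExpectedTime≤ (base H) (fromℕ (proj₁ fast * (1 + numEdges H * a * ⌈log₂ n ⌉))))
                                  (sym (^-identityʳ (arboricity H))) (proj₂ fast H))
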